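{- The polynomials that are both quasi-key and Young quasi-key polynomials are precisely the $\hat{\mathfrak Q}_a$ such that $a$ is a number of equal parts followed by zeros, or a sequence of $1$'s and $2$'s followed by zeros, or $a$ has no zero parts and consecutive parts differ by at most $1$.
   Context: Weak compositions have length $n$. The quasi-key polynomial $\mathfrak Q_a$ (Assaf–Searles) is the generating function of fillings of the diagram of $a$ (row $i$ has $a_i$ left-justified boxes) such that entries weakly decrease along rows, no entry in row $i$ exceeds $i$, entries strictly increase up the first column and are distinct within each column, and every triple is an inversion triple: a type A triple is boxes $z,x$ adjacent in a row ($z$ left) with $y$ above $x$ in a higher row, the lower row weakly longer; a type B triple is $z,x$ adjacent in a row with $y$ below $z$ in a lower row, the higher row strictly longer; it is an inversion triple unless $z\ge y\ge x$. The Young quasi-key polynomial is $\hat{\mathfrak Q}_a(x_1,\ldots,x_n)=\mathfrak Q_{\mathrm{rev}(a)}(x_n,\ldots,x_1)$, where $\mathrm{rev}(a)$ is $a$ reversed. -}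

module Defs where

open import Data.Nat using (ℕ; zero; suc; _+_; _∸_; _≤_; _<_; _≤ᵇ_; _<ᵇ_; _≡ᵇ_)
open import Data.Bool using (Bool; true; false; _∧_; _∨_; not; if_then_else_)
open import Data.List using (List; []; _∷_; map; concatMap; upTo; length; filter; reverse; replicate; _++_; foldr)
open import Data.List.Relation.Unary.All using (All)
open import Data.Vec using (Vec; toList)
open import Data.Product using (Σ; ∃; _×_; _,_)
open import Data.Sum using (_⊎_)
open import Relation.Binary.PropositionalEquality using (_≡_)
open import Relation.Nullary.Decidable using (does)
open import Data.Bool.Properties using (T?)
open import Data.Bool using (T)

-- Conventions.
-- A weak composition of length n is a list/vector of n naturals a₁ … aₙ.
-- The diagram of a has, in row i (1-indexed, row 1 at the bottom,
-- "higher" rows have larger index), the cells (i , c) for 1 ≤ c ≤ aᵢ.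
-- A filling is a list of rows; row i is a list of length aᵢ whose c-th
-- element (1-indexed) is the entry of cell (i , c).

-- 1-indexed lookup with default 0
at : List ℕ → ℕ → ℕ
at []       _             = 0
at (x ∷ xs) 0             = 0
at (x ∷ xs) 1             = x
at (x ∷ xs) (suc (suc k)) = at xs (suc k)

rowAt : List (List ℕ) → ℕ → List ℕ
rowAt []       _             = []
rowAt (r ∷ rs) 0             = []
rowAt (r ∷ rs) 1             = r
rowAt (r ∷ rs) (suc (suc k)) = rowAt rs (suc k)

range1 : ℕ → List ℕ
range1 m = map suc (upTo m)

allB : List ℕ → (ℕ → Bool) → Bool
allB xs p = foldr (λ x b → p x ∧ b) true xs

ent : List (List ℕ) → ℕ → ℕ → ℕ
ent T i c = at (rowAt T i) c

invTriple : ℕ → ℕ → ℕ → Bool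
invTriple z y x = not ((y ≤ᵇ z) ∧ (x ≤ᵇ y))

module _ (a : List ℕ) (T : List (List ℕ)) where
  private
    n = length a
    len : ℕ → ℕ
    len i = at a i
    rows = range1 n
    cols : ℕ → List ℕ
    cols i = range1 (len i)

  rowsWeaklyDecrease : Bool
  rowsWeaklyDecrease = allB rows λ i → allB (cols i) λ c →
    if suc c ≤ᵇ len i then ent T i (suc c) ≤ᵇ ent T i c else true

  entriesBounded : Bool
  entriesBounded = allB rows λ i → allB (cols i) λ c →
    (1 ≤ᵇ ent T i c) ∧ (ent T i c ≤ᵇ i)

  firstColumnIncreasing : Bool
  firstColumnIncreasing = allB rows λ i → allB rows λ j →
    if (i <ᵇ j) ∧ (1 ≤ᵇ len i) ∧ (1 ≤ᵇ len j)
    then ent T i 1 <ᵇ ent T j 1 else true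

  columnsDistinct : Bool
  columnsDistinct = allB rows λ i → allB rows λ j → allB (cols i) λ c →
    if (i <ᵇ j) ∧ (c ≤ᵇ len j) then not (ent T i c ≡ᵇ ent T j c) else true

  typeAInversions : Bool
  typeAInversions = allB rows λ i → allB rows λ j → allB (cols i) λ c →
    if (i <ᵇ j) ∧ (suc c ≤ᵇ len i) ∧ (suc c ≤ᵇ len j) ∧ (len j ≤ᵇ len i)
    then invTriple (ent T i c) (ent T j (suc c)) (ent T i (suc c)) else true

  typeBInversions : Bool
  typeBInversions = allB rows λ i → allB rows λ j → allB (cols i) λ c →
    if (j <ᵇ i) ∧ (suc c ≤ᵇ len i) ∧ (c ≤ᵇ len j) ∧ (len j <ᵇ len i)
    then invTriple (ent T i c) (ent T j c) (ent T i (suc c)) else true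

  isQuasiKeyFilling : Bool
  isQuasiKeyFilling = rowsWeaklyDecrease ∧ entriesBounded ∧ firstColumnIncreasing
    ∧ columnsDistinct ∧ typeAInversions ∧ typeBInversions

listsOf : ℕ → ℕ → List (List ℕ)
listsOf zero    m = [] ∷ []
listsOf (suc l) m = concatMap (λ x → map (x ∷_) (listsOf l m)) (range1 m)

fillingsOf : List ℕ → ℕ → List (List (List ℕ))
fillingsOf []       m = [] ∷ []
fillingsOf (r ∷ rs) m = concatMap (λ row → map (row ∷_) (fillingsOf rs m)) (listsOf r m)

countEntry : ℕ → List (List ℕ) → ℕ
countEntry k T = foldr (λ r s → length (filter (λ x → T? (x ≡ᵇ k)) r) + s) 0 T

hasWeight : List ℕ → List (List ℕ) → Bool
hasWeight w T = allB (range1 (length w)) λ k → countEntry k T ≡ᵇ at w k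

-- a polynomial with ℕ coefficients in n variables, as its coefficient function
Poly : ℕ → Set
Poly n = Vec ℕ n → ℕ

_≈P_ : ∀ {n} → Poly n → Poly n → Set
P ≈P Q = ∀ w → P w ≡ Q w

coeffQK : List ℕ → List ℕ → ℕ
coeffQK a w = length (filter (λ T → T? (isQuasiKeyFilling a T ∧ hasWeight w T))
                             (fillingsOf a (length a)))

quasiKey : ∀ {n} → Vec ℕ n → Poly n
quasiKey a w = coeffQK (toList a) (toList w)

-- Young quasi-key polynomial 𝔔̂_a(x₁,…,xₙ) = 𝔔_{rev a}(xₙ,…,x₁):
-- its x^w coefficient is the x^{rev w} coefficient of 𝔔_{rev a}
youngQuasiKey : ∀ {n} → Vec ℕ n → Poly n
youngQuasiKey a w = coeffQK (reverse (toList a)) (reverse (toList w))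

EqualPartsThenZeros : ∀ {n} → Vec ℕ n → Set
EqualPartsThenZeros a = Σ ℕ λ k → Σ ℕ λ p → Σ ℕ λ q →
  toList a ≡ replicate p k ++ replicate q 0

OnesTwosThenZeros : ∀ {n} → Vec ℕ n → Set
OnesTwosThenZeros a = Σ (List ℕ) λ l → Σ ℕ λ q →
  All (λ x → x ≡ 1 ⊎ x ≡ 2) l × toList a ≡ l ++ replicate q 0

data AdjDiffLe1 : List ℕ → Set where
  []  : AdjDiffLe1 []
  [_] : ∀ x → AdjDiffLe1 (x ∷ [])
  _∷_ : ∀ {x y xs} → (x ≤ suc y) × (y ≤ suc x) → AdjDiffLe1 (y ∷ xs) → AdjDiffLe1 (x ∷ y ∷ xs)

NoZerosAdjDiffLe1 : ∀ {n} → Vec ℕ n → Set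
NoZerosAdjDiffLe1 a = All (λ x → 0 < x) (toList a) × AdjDiffLe1 (toList a)

Condition : ∀ {n} → Vec ℕ n → Set
Condition a = EqualPartsThenZeros a ⊎ OnesTwosThenZeros a ⊎ NoZerosAdjDiffLe1 a

-- Say that T and U mirror each other if U contains n+1-k as often as T contains k.
--
-- Necessity. Put A = rev a. If 𝔔_b is also the Young quasi-key polynomial of a, then every filling
-- of A has a mirror filling of b, and conversely. Mirroring well-chosen fillings restricts a and b.
-- Pushing the nonzero rows of A down shows that b consists of q zeros followed by positive parts,
-- and similarly for A. The filling of A by its row numbers has a mirror filling of b whose rows
-- turn out to be constant, since repeating a value in a column further right that misses the
-- previous column loses in the sum of the (w_k - c)⁺ over the weight w; hence the positive parts
-- of a are those of b. Changing a single last entry in a filling with constant rows gives fillings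
-- without a mirror image if adjacent parts differ by 2 or more, or if q > 0 and some adjacent
-- parts are {k, k+1} with k ≥ 2.
--
-- Sufficiency. If no part is zero and adjacent parts differ by at most 1, the filling by row
-- numbers is the only one. For a rectangle, a filling is determined by the sets of entries of its
-- columns, and reversing the order of the columns and complementing their entries is an injection.
-- In a sequence of 1's and 2's, a row of length 1 separates the entries below it from those above
-- it, so the runs of 2's can be treated as independent rectangles.

module Submission where

open import Defs
open import Data.Bool using (Bool; true; false; not; _∧_; if_then_else_)
  renaming (T to So)
open import Data.Bool.Properties using (T-∧; T?)
open import Data.Empty using (⊥)
open import Data.List using (List; []; _∷_; _++_; _∷ʳ_; map; length; filter; concatMap; applyUpTo; cartesianProductWith;
  take; drop; replicate; reverse)
open import Data.List.Membership.Propositional using (_∈_)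
open import Data.List.Membership.Propositional.Properties
  using (∈-cartesianProductWith⁺; ∈-cartesianProductWith⁻; ∈-filter⁺; ∈-filter⁻; ∈-applyUpTo⁺; ∈-map⁺;
    ∈-∃++; ∈-++⁺ˡ; ∈-++⁺ʳ; ∈-++⁻; ∈-length)
open import Data.List.Properties
open import Data.List.Relation.Binary.Permutation.Propositional as ↭
  using (_↭_; ↭-refl; ↭-sym; ↭-trans; ↭-prep; ↭-swap; ↭-reflexive)
open import Data.List.Relation.Binary.Permutation.Propositional.Properties
  using (∈-resp-↭; All-resp-↭; drop-∷; ↭-length; filter-↭; ↭-empty-inv; ↭-reverse; map⁺)
open import Data.List.Relation.Binary.Pointwise using (Pointwise; []; _∷_)
open import Data.List.Relation.Unary.All as All using (All; []; _∷_)
import Data.List.Relation.Unary.All.Properties as All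
open import Data.List.Relation.Unary.AllPairs as AllPairs using (AllPairs; []; _∷_)
import Data.List.Relation.Unary.AllPairs.Properties as AllPairs
open import Data.List.Relation.Unary.Any using (here; there)
open import Data.List.Relation.Unary.Linked.Properties using (Linked⇒AllPairs)
open import Data.List.Relation.Unary.Unique.Propositional using (Unique)
import Data.List.Relation.Unary.Unique.Propositional.Properties as Unique
open import Data.Nat hiding (_!)
open import Data.Nat.Properties
open import Data.Nat.Tactic.RingSolver using (solve-∀)
open import Data.List.Sort ≤-decTotalOrder using (sort; sort-↭; sort-↗)
open import Data.Product using (Σ; ∃; _×_; _,_; proj₁; proj₂)
open import Data.Sum using (_⊎_; inj₁; inj₂)
open import Data.Unit using (⊤; tt)
open import Data.Vec as Vec using (Vec; toList)
open import Data.Vec.Properties using (length-toList; toList∘fromList)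
open import Function using (_∘_; id)
open import Function.Bundles using (_⇔_; mk⇔; Equivalence)
open import Relation.Binary.Definitions using (tri<; tri≈; tri>)
open import Relation.Binary.PropositionalEquality hiding ([_])
open import Relation.Nullary using (¬_; yes; no; contradiction)

-- Necessity uses only which coefficients vanish. The mirror filling is then an unknown object, and
-- its cells have to be forced from its contents alone. The main lever is that entries of row i are
-- at most i: going down from the top row, if all larger values fill their own rows, then the value
-- k can only occur in row k, and it fills that row as soon as it occurs often enough. For
-- sufficiency the same bound by row number is the obstacle, since it does not survive cutting a
-- filling into pieces and exchanging them. There it is weakened to the bound n, and recovered at
-- the end from the strict increase of the first column. The order inside a column of a rectangle
-- carries no information because, for rows of equal length, decreasing rows and type A triples say
-- together that each cell, from the bottom up, holds the largest entry still left that does not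
-- exceed its left neighbour.

-- Positions counted from 0, in contrast with the 1-indexed `at` and `rowAt`.
infixl 9 _!_ _‼_
_!_ : List ℕ → ℕ → ℕ
r ! c = at r (suc c)

_‼_ : List (List ℕ) → ℕ → List ℕ
T ‼ i = rowAt T (suc i)

-- The conditions on a lower row r and a higher row s.
record Compatible (r s : List ℕ) : Set where
  field
    first-increasing : 0 < length r → 0 < length s → r ! 0 < s ! 0
    distinct : ∀ c → c < length r → c < length s → r ! c ≢ s ! c
    typeA : ∀ c → suc c < length r → suc c < length s → length s ≤ length r →
            ¬ (s ! suc c ≤ r ! c × r ! suc c ≤ s ! suc c)
    typeB : ∀ c → c < length r → suc c < length s → length r < length s →
            ¬ (r ! c ≤ s ! c × s ! suc c ≤ r ! c)
open Compatible public

Decreasing : List ℕ → Set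
Decreasing r = ∀ c → suc c < length r → r ! suc c ≤ r ! c

Within : ℕ → List ℕ → Set
Within m r = ∀ c → c < length r → 1 ≤ r ! c × r ! c ≤ m

record Valid (T : List (List ℕ)) : Set where
  field
    decreasing : ∀ i → i < length T → Decreasing (T ‼ i)
    bounded    : ∀ i → i < length T → Within (suc i) (T ‼ i)
    compatible : ∀ i j → i < j → j < length T → Compatible (T ‼ i) (T ‼ j)
open Valid public

record Filling (a : List ℕ) (T : List (List ℕ)) : Set where
  field
    shape : map length T ≡ a
    valid : Valid T
open Filling public

!-map-length : ∀ T i → map length T ! i ≡ length (T ‼ i)
!-map-length []      i       = refl
!-map-length (r ∷ T) zero    = refl
!-map-length (r ∷ T) (suc i) = !-map-length T i

-- Booleans

So-allB⁻ : ∀ xs {p} → So (allB xs p) → All (So ∘ p) xs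
So-allB⁻ []       h = []
So-allB⁻ (x ∷ xs) h = let (px , ps) = Equivalence.to T-∧ h in px ∷ So-allB⁻ xs ps

So-allB⁺ : ∀ {xs p} → All (So ∘ p) xs → So (allB xs p)
So-allB⁺ []       = tt
So-allB⁺ (p ∷ ps) = Equivalence.from T-∧ (p , So-allB⁺ ps)

So-allRange⁻ : ∀ m {p} → So (allB (range1 m) p) → ∀ i → i < m → So (p (suc i))
So-allRange⁻ m h i i<m =
  All.lookup (So-allB⁻ (range1 m) h) (∈-map⁺ suc (∈-applyUpTo⁺ id i<m))

So-allRange⁺ : ∀ m {p} → (∀ i → i < m → So (p (suc i))) → So (allB (range1 m) p)
So-allRange⁺ m h = So-allB⁺ (All.map⁺ (All.applyUpTo⁺₁ id m (λ {i} → h i)))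

So-if⁻ : ∀ {b e} → So (if b then e else true) → So b → So e
So-if⁻ {true} h _ = h

So-if⁺ : ∀ {b e} → (So b → So e) → So (if b then e else true)
So-if⁺ {true}  h = h tt
So-if⁺ {false} h = tt

So-∧⁻ : ∀ {x y} → So (x ∧ y) → So x × So y
So-∧⁻ = Equivalence.to T-∧

So-∧⁺ : ∀ {x y} → So x → So y → So (x ∧ y)
So-∧⁺ p q = Equivalence.from T-∧ (p , q)

So-not⁻ : ∀ {b} → So (not b) → ¬ So b
So-not⁻ {false} _ ()

So-not⁺ : ∀ {b} → ¬ So b → So (not b)
So-not⁺ {true}  h = h tt
So-not⁺ {false} h = tt

So-invTriple⁻ : ∀ z y x → So (invTriple z y x) → ¬ (y ≤ z × x ≤ y)
So-invTriple⁻ z y x h (p , q) = So-not⁻ h (So-∧⁺ (≤⇒≤ᵇ p) (≤⇒≤ᵇ q))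

So-invTriple⁺ : ∀ z y x → ¬ (y ≤ z × x ≤ y) → So (invTriple z y x)
So-invTriple⁺ z y x h =
  So-not⁺ λ t → let (p , q) = So-∧⁻ t in h (≤ᵇ⇒≤ _ _ p , ≤ᵇ⇒≤ _ _ q)

module _ {a : List ℕ} {T′ : List (List ℕ)} (sh : map length T′ ≡ a) where

  private
    n = length a

    n≡ : n ≡ length T′
    n≡ = trans (cong length (sym sh)) (length-map length T′)

    len≡ : ∀ i → a ! i ≡ length (T′ ‼ i)
    len≡ i = trans (cong (_! i) (sym sh)) (!-map-length T′ i)

    <n : ∀ {i} → i < length T′ → i < n
    <n = subst (_ <_) (sym n≡)

    n< : ∀ {i} → i < n → i < length T′
    n< = subst (_ <_) n≡

    <l : ∀ i {c} → c < length (T′ ‼ i) → c < a ! i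
    <l i = subst (_ <_) (sym (len≡ i))

    l< : ∀ i {c} → c < a ! i → c < length (T′ ‼ i)
    l< i = subst (_ <_) (len≡ i)

  valid⁻ : So (isQuasiKeyFilling a T′) → Valid T′
  valid⁻ h with So-∧⁻ {rowsWeaklyDecrease a T′} h
  ... | h₁ , h′ with So-∧⁻ {entriesBounded a T′} h′
  ... | h₂ , h″ with So-∧⁻ {firstColumnIncreasing a T′} h″
  ... | h₃ , h‴ with So-∧⁻ {columnsDistinct a T′} h‴
  ... | h₄ , h⁗ with So-∧⁻ {typeAInversions a T′} h⁗
  ... | h₅ , h₆ = record
    { decreasing = λ i i< c c< → ≤ᵇ⇒≤ _ _
        (So-if⁻ (So-allRange⁻ (a ! i) (So-allRange⁻ n h₁ i (<n i<)) c (<l i (<⇒≤ c<))) (≤⇒≤ᵇ (<l i c<)))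
    ; bounded = λ i i< c c< →
        let (p , q) = So-∧⁻ (So-allRange⁻ (a ! i) (So-allRange⁻ n h₂ i (<n i<)) c (<l i c<))
        in ≤ᵇ⇒≤ _ _ p , ≤ᵇ⇒≤ _ _ q
    ; compatible = λ i j i<j j< → let i< = <-trans i<j j< in record
        { first-increasing = λ p q → <ᵇ⇒< _ _
            (So-if⁻ (So-allRange⁻ n (So-allRange⁻ n h₃ i (<n i<)) j (<n j<))
              (So-∧⁺ (<⇒<ᵇ (s<s i<j)) (So-∧⁺ (≤⇒≤ᵇ (<l i p)) (≤⇒≤ᵇ (<l j q)))))
        ; distinct = λ c p q e → So-not⁻
            (So-if⁻ (So-allRange⁻ (a ! i) (So-allRange⁻ n (So-allRange⁻ n h₄ i (<n i<)) j (<n j<)) c (<l i p))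
              (So-∧⁺ (<⇒<ᵇ (s<s i<j)) (≤⇒≤ᵇ (<l j q)))) (≡⇒≡ᵇ _ _ e)
        ; typeA = λ c p q le → So-invTriple⁻ _ _ _
            (So-if⁻ (So-allRange⁻ (a ! i) (So-allRange⁻ n (So-allRange⁻ n h₅ i (<n i<)) j (<n j<)) c (<l i (<⇒≤ p)))
              (So-∧⁺ (<⇒<ᵇ (s<s i<j)) (So-∧⁺ (≤⇒≤ᵇ (<l i p)) (So-∧⁺ (≤⇒≤ᵇ (<l j q))
                (≤⇒≤ᵇ (subst₂ _≤_ (sym (len≡ j)) (sym (len≡ i)) le))))))
        ; typeB = λ c p q lt → So-invTriple⁻ _ _ _
            (So-if⁻ (So-allRange⁻ (a ! j) (So-allRange⁻ n (So-allRange⁻ n h₆ j (<n j<)) i (<n i<)) c (<l j (<⇒≤ q)))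
              (So-∧⁺ (<⇒<ᵇ (s<s i<j)) (So-∧⁺ (≤⇒≤ᵇ (<l j q)) (So-∧⁺ (≤⇒≤ᵇ (<l i p))
                (<⇒<ᵇ (subst₂ _<_ (sym (len≡ i)) (sym (len≡ j)) lt))))))
        }
    }

  valid⁺ : Valid T′ → So (isQuasiKeyFilling a T′)
  valid⁺ v =
    So-∧⁺ {rowsWeaklyDecrease a T′} (So-allRange⁺ n λ i i< → So-allRange⁺ (a ! i) λ c c< →
      So-if⁺ λ t → ≤⇒≤ᵇ (decreasing v i (n< i<) c (l< i (≤ᵇ⇒≤ _ _ t))))
    (So-∧⁺ {entriesBounded a T′} (So-allRange⁺ n λ i i< → So-allRange⁺ (a ! i) λ c c< →
      let (p , q) = bounded v i (n< i<) c (l< i c<) in So-∧⁺ (≤⇒≤ᵇ p) (≤⇒≤ᵇ q))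
    (So-∧⁺ {firstColumnIncreasing a T′} (So-allRange⁺ n λ i i< → So-allRange⁺ n λ j j< →
      So-if⁺ λ t → let (i<j , t′) = So-∧⁻ t ; (p , q) = So-∧⁻ t′ in
        <⇒<ᵇ (first-increasing (compatible v i j (s<s⁻¹ (<ᵇ⇒< _ _ i<j)) (n< j<))
               (l< i (≤ᵇ⇒≤ _ _ p)) (l< j (≤ᵇ⇒≤ _ _ q))))
    (So-∧⁺ {columnsDistinct a T′} (So-allRange⁺ n λ i i< → So-allRange⁺ n λ j j< → So-allRange⁺ (a ! i) λ c c< →
      So-if⁺ λ t → let (i<j , q) = So-∧⁻ t in
        So-not⁺ λ e → distinct (compatible v i j (s<s⁻¹ (<ᵇ⇒< _ _ i<j)) (n< j<))
               c (l< i c<) (l< j (≤ᵇ⇒≤ _ _ q)) (≡ᵇ⇒≡ _ _ e))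
    (So-∧⁺ {typeAInversions a T′} (So-allRange⁺ n λ i i< → So-allRange⁺ n λ j j< → So-allRange⁺ (a ! i) λ c c< →
      So-if⁺ λ t → let (i<j , t′) = So-∧⁻ t ; (p , t″) = So-∧⁻ t′ ; (q , le) = So-∧⁻ t″ in
        So-invTriple⁺ _ _ _ (typeA (compatible v i j (s<s⁻¹ (<ᵇ⇒< _ _ i<j)) (n< j<))
               c (l< i (≤ᵇ⇒≤ _ _ p)) (l< j (≤ᵇ⇒≤ _ _ q)) (subst₂ _≤_ (len≡ j) (len≡ i) (≤ᵇ⇒≤ _ _ le))))
    (So-allRange⁺ n λ j j< → So-allRange⁺ n λ i i< → So-allRange⁺ (a ! j) λ c c< →
      So-if⁺ λ t → let (i<j , t′) = So-∧⁻ t ; (q , t″) = So-∧⁻ t′ ; (p , lt) = So-∧⁻ t″ in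
        So-invTriple⁺ _ _ _ (typeB (compatible v i j (s<s⁻¹ (<ᵇ⇒< _ _ i<j)) (n< j<))
               c (l< i (≤ᵇ⇒≤ _ _ p)) (l< j (≤ᵇ⇒≤ _ _ q)) (subst₂ _<_ (len≡ i) (len≡ j) (<ᵇ⇒< _ _ lt))))))))

-- Enumeration of fillings

concatMap-cartesian : ∀ {A B C : Set} (f : A → B → C) xs ys →
                concatMap (λ x → map (f x) ys) xs ≡ cartesianProductWith f xs ys
concatMap-cartesian f []       ys = refl
concatMap-cartesian f (x ∷ xs) ys = cong (map (f x) ys ++_) (concatMap-cartesian f xs ys)

∈-range1⁺ : ∀ {m x} → 1 ≤ x → x ≤ m → x ∈ range1 m
∈-range1⁺ (s≤s _) x≤m = ∈-map⁺ suc (∈-applyUpTo⁺ id x≤m)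

listsOf-suc : ∀ l m → listsOf (suc l) m ≡ cartesianProductWith _∷_ (range1 m) (listsOf l m)
listsOf-suc l m = concatMap-cartesian _∷_ (range1 m) (listsOf l m)

fillingsOf-∷ : ∀ l a m → fillingsOf (l ∷ a) m ≡ cartesianProductWith _∷_ (listsOf l m) (fillingsOf a m)
fillingsOf-∷ l a m = concatMap-cartesian _∷_ (listsOf l m) (fillingsOf a m)

∈-listsOf⁺ : ∀ {m} r → Within m r → r ∈ listsOf (length r) m
∈-listsOf⁺ []      w = here refl
∈-listsOf⁺ {m} (x ∷ r) w = subst (_ ∈_) (sym (listsOf-suc (length r) m))
  (let (p , q) = w 0 (s≤s z≤n) in
   ∈-cartesianProductWith⁺ _∷_ (∈-range1⁺ p q) (∈-listsOf⁺ r (λ c c< → w (suc c) (s<s c<))))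

listsOf-length : ∀ l {m r} → r ∈ listsOf l m → length r ≡ l
listsOf-length zero    (here refl) = refl
listsOf-length (suc l) {m} r∈
  with _ , r , _ , r∈′ , refl ← ∈-cartesianProductWith⁻ _∷_ (range1 m) (listsOf l m)
                                  (subst (_ ∈_) (listsOf-suc l m) r∈)
  = cong suc (listsOf-length l r∈′)

∈-fillingsOf⁺ : ∀ {m} T → (∀ i → i < length T → Within m (T ‼ i)) → T ∈ fillingsOf (map length T) m
∈-fillingsOf⁺ []      w = here refl
∈-fillingsOf⁺ {m} (r ∷ T) w = subst (_ ∈_) (sym (fillingsOf-∷ (length r) (map length T) m))
  (∈-cartesianProductWith⁺ _∷_ (∈-listsOf⁺ r (w 0 (s≤s z≤n))) (∈-fillingsOf⁺ T (λ i i< → w (suc i) (s<s i<))))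

fillingsOf-shape : ∀ a {m T} → T ∈ fillingsOf a m → map length T ≡ a
fillingsOf-shape []      (here refl) = refl
fillingsOf-shape (l ∷ a) {m} T∈
  with _ , _ , r∈ , T∈′ , refl ← ∈-cartesianProductWith⁻ _∷_ (listsOf l m) (fillingsOf a m)
                                   (subst (_ ∈_) (fillingsOf-∷ l a m) T∈)
  = cong₂ _∷_ (listsOf-length l r∈) (fillingsOf-shape a T∈′)

listsOf-unique : ∀ l m → Unique (listsOf l m)
listsOf-unique zero    m = [] ∷ []
listsOf-unique (suc l) m = subst Unique (sym (listsOf-suc l m))
  (Unique.cartesianProductWith⁺ _∷_ ∷-injective
    (Unique.map⁺ suc-injective (Unique.upTo⁺ m)) (listsOf-unique l m))

fillingsOf-unique : ∀ a m → Unique (fillingsOf a m)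
fillingsOf-unique []      m = [] ∷ []
fillingsOf-unique (l ∷ a) m = subst Unique (sym (fillingsOf-∷ l a m))
  (Unique.cartesianProductWith⁺ _∷_ ∷-injective (listsOf-unique l m) (fillingsOf-unique a m))

-- Coefficients

HasWeight : List ℕ → List (List ℕ) → Set
HasWeight w T = ∀ k → k < length w → countEntry (suc k) T ≡ w ! k

isCounted : (a w : List ℕ) (T : List (List ℕ)) → Bool
isCounted a w T = isQuasiKeyFilling a T ∧ hasWeight w T

fillings : List ℕ → List ℕ → List (List (List ℕ))
fillings a w = filter (λ T → T? (isCounted a w T)) (fillingsOf a (length a))

∈-fillings⁺ : ∀ {a w T} → Filling a T → HasWeight w T → T ∈ fillings a w
∈-fillings⁺ {a} {w} {T} f h = ∈-filter⁺ (λ T → T? (isCounted a w T))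
  (subst₂ (λ s m → T ∈ fillingsOf s m) (shape f) (length≡ (shape f))
    (∈-fillingsOf⁺ T λ i i< c c< → let (p , q) = bounded (valid f) i i< c c< in p , ≤-trans q i<))
  (So-∧⁺ (valid⁺ (shape f) (valid f)) (So-allRange⁺ (length w) λ k k< → ≡⇒≡ᵇ _ _ (h k k<)))
  where
  length≡ : ∀ {a} → map length T ≡ a → length T ≡ length a
  length≡ refl = sym (length-map length T)

∈-fillings⁻ : ∀ {a w T} → T ∈ fillings a w → Filling a T × HasWeight w T
∈-fillings⁻ {a} {w} {T} T∈
  with T∈′ , t ← ∈-filter⁻ (λ T → T? (isCounted a w T)) T∈
  with q , h ← So-∧⁻ {isQuasiKeyFilling a T} t
  = record { shape = sh ; valid = valid⁻ sh q }
  , λ k k< → ≡ᵇ⇒≡ _ _ (So-allRange⁻ (length w) h k k<)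
  where sh = fillingsOf-shape a T∈′

fillings-unique : ∀ a w → Unique (fillings a w)
fillings-unique a w = Unique.filter⁺ (λ T → T? (isCounted a w T)) (fillingsOf-unique a (length a))

-- Delete from `ys` the partner of the first element: by injectivity no later element can have it,
-- so the rest still finds partners. A relation replaces a function because partners arrive as
-- existential witnesses, and only what is recorded about them is needed to recover the element.
injection-length : ∀ {A B : Set} (R : A → B → Set) {xs : List A} (ys : List B) → Unique xs →
  (∀ {x} → x ∈ xs → ∃ λ y → y ∈ ys × R x y) →
  (∀ {x x′ y} → x ∈ xs → x′ ∈ xs → R x y → R x′ y → x ≡ x′) →
  length xs ≤ length ys
injection-length R {[]}     ys u        total inj = z≤n
injection-length R {x ∷ xs} ys (x∉ ∷ u) total inj
  with y , y∈ , xRy ← total (here refl)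
  with ys₁ , ys₂ , refl ← ∈-∃++ y∈ = begin
  suc (length xs)               ≤⟨ s≤s (injection-length R (ys₁ ++ ys₂) u total′
                                     (λ p q → inj (there p) (there q))) ⟩
  suc (length (ys₁ ++ ys₂))     ≡⟨ cong suc (length-++ ys₁) ⟩
  suc (length ys₁ + length ys₂) ≡⟨ +-suc (length ys₁) (length ys₂) ⟨
  length ys₁ + suc (length ys₂) ≡⟨ length-++ ys₁ ⟨
  length (ys₁ ++ y ∷ ys₂)       ∎
  where
  open ≤-Reasoning
  total′ : ∀ {x′} → x′ ∈ xs → ∃ λ y′ → y′ ∈ ys₁ ++ ys₂ × R x′ y′
  total′ x′∈ with y′ , y′∈ , r ← total (there x′∈) with ∈-++⁻ ys₁ y′∈
  ... | inj₁ p           = y′ , ∈-++⁺ˡ p , r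
  ... | inj₂ (here refl) = contradiction (inj (here refl) (there x′∈) xRy r) (All.lookup x∉ x′∈)
  ... | inj₂ (there p)   = y′ , ∈-++⁺ʳ ys₁ p , r

!-applyUpTo : ∀ f {n c} → c < n → applyUpTo f n ! c ≡ f c
!-applyUpTo f {suc n} {zero}  c<n = refl
!-applyUpTo f {suc n} {suc c} c<n = !-applyUpTo (f ∘ suc) (s<s⁻¹ c<n)

‼-applyUpTo : ∀ f {n i} → i < n → applyUpTo f n ‼ i ≡ f i
‼-applyUpTo f {suc n} {zero}  i<n = refl
‼-applyUpTo f {suc n} {suc i} i<n = ‼-applyUpTo (f ∘ suc) (s<s⁻¹ i<n)

!-∷ʳ-length : ∀ xs x → (xs ∷ʳ x) ! length xs ≡ x
!-∷ʳ-length []       x = refl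
!-∷ʳ-length (_ ∷ xs) x = !-∷ʳ-length xs x

!-∷ʳ-< : ∀ xs x {i} → i < length xs → (xs ∷ʳ x) ! i ≡ xs ! i
!-∷ʳ-< (_ ∷ xs) x {zero}  i< = refl
!-∷ʳ-< (_ ∷ xs) x {suc i} i< = !-∷ʳ-< xs x (s<s⁻¹ i<)

!-reverse : ∀ xs i j → i + suc j ≡ length xs → reverse xs ! i ≡ xs ! j
!-reverse []       i j eq = contradiction (trans (sym (+-suc i j)) eq) λ ()
!-reverse (x ∷ xs) i j eq rewrite unfold-reverse x xs
  with j | suc-injective (trans (sym (+-suc i j)) eq)
... | zero   | eq′ rewrite trans (trans (sym (+-identityʳ i)) eq′) (sym (length-reverse xs)) =
  !-∷ʳ-length (reverse xs) x
... | suc j′ | eq′ = trans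
  (!-∷ʳ-< (reverse xs) x (subst (i <_) (trans eq′ (sym (length-reverse xs))) (m<m+n i z<s)))
  (!-reverse xs i j′ eq′)

opposite : ∀ {n k} → k < n → ∃ λ j → k + suc j ≡ n
opposite {n} {k} k<n = n ∸ suc k , trans (+-suc k (n ∸ suc k)) (m+[n∸m]≡n k<n)

opposite-< : ∀ {n} i {j} → i + suc j ≡ n → j < n
opposite-< i refl = m≤n+m _ i

opposite-swap : ∀ {n} i j → i + suc j ≡ n → j + suc i ≡ n
opposite-swap i j eq = trans (+-suc j i) (trans (cong suc (+-comm j i)) (trans (sym (+-suc i j)) eq))

-- The contents of U are those of T after x_k ↦ x_{n+1-k}.
record Reversed (n : ℕ) (T U : List (List ℕ)) : Set where
  constructor reversed
  field
    mirror : ∀ i j → i + suc j ≡ n → countEntry (suc i) U ≡ countEntry (suc j) T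
open Reversed public

hasWeight-reverse : ∀ {n} w {T U} → length w ≡ n → Reversed n T U → HasWeight w T → HasWeight (reverse w) U
hasWeight-reverse w refl rev h k k< with j , eq ← opposite (subst (k <_) (length-reverse w) k<) =
  trans (mirror rev k j eq) (trans (h j (opposite-< k eq)) (sym (!-reverse w k j eq)))

coeffQK-≤ : ∀ {n a b w} (R : (T U : List (List ℕ)) → Set) → length w ≡ n →
  (∀ T → Filling a T → ∃ λ U → Filling b U × Reversed n T U × R T U) →
  (∀ {T T′ U} → Filling a T → Filling a T′ → R T U → R T′ U → T ≡ T′) →
  coeffQK a w ≤ coeffQK b (reverse w)
coeffQK-≤ {n} {a} {b} {w} R len total inj =
  injection-length R (fillings b (reverse w)) (fillings-unique a w)
    (λ {T} T∈ → let (f , h) = ∈-fillings⁻ {a} {w} T∈ ; (U , g , rev , r) = total T f in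
      U , ∈-fillings⁺ {b} {reverse w} g (hasWeight-reverse w len rev h) , r)
    (λ {T} {T′} p q → inj (proj₁ (∈-fillings⁻ {a} {w} {T} p)) (proj₁ (∈-fillings⁻ {a} {w} {T′} q)))

nonempty : ∀ {A : Set} {xs : List A} → 0 < length xs → ∃ (_∈ xs)
nonempty {xs = x ∷ xs} _ = x , here refl

Mirrors : ℕ → (a b : List ℕ) → Set
Mirrors n a b = ∀ T → Filling a T → ∃ λ U → Filling b U × Reversed n T U

-- For `w` take the contents of T. The coefficient counts T itself, so it is positive, and the equal
-- coefficient on the other side must count some U.
coeffQK-mirrors : ∀ {n a b} → (∀ w → length w ≡ n → coeffQK a w ≡ coeffQK b (reverse w)) → Mirrors n a b
coeffQK-mirrors {n} {a} {b} eq T f = U , g , reversed rev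
  where
  w = applyUpTo (λ k → countEntry (suc k) T) n

  |w| : length w ≡ n
  |w| = length-applyUpTo _ n

  w! : ∀ {k} → k < n → w ! k ≡ countEntry (suc k) T
  w! = !-applyUpTo (λ k → countEntry (suc k) T)

  T∈ : T ∈ fillings a w
  T∈ = ∈-fillings⁺ {a} {w} f λ k k< → sym (w! (subst (k <_) |w| k<))

  U∈∃ : ∃ (_∈ fillings b (reverse w))
  U∈∃ = nonempty (subst (0 <_) (eq w |w|) (∈-length T∈))

  U = proj₁ U∈∃

  g = proj₁ (∈-fillings⁻ {b} {reverse w} (proj₂ U∈∃))

  rev : ∀ i j → i + suc j ≡ n → countEntry (suc i) U ≡ countEntry (suc j) T
  rev i j e = trans
    (proj₂ (∈-fillings⁻ {b} {reverse w} (proj₂ U∈∃)) i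
      (subst (i <_) (sym (trans (length-reverse w) |w|)) (opposite-< j (opposite-swap i j e))))
    (trans (!-reverse w i j (trans e (sym |w|))) (w! (opposite-< i e)))

-- Counting entries

count : ℕ → List ℕ → ℕ
count k r = length (filter (λ x → T? (x ≡ᵇ k)) r)

count-∷-≡ : ∀ {k x} r → x ≡ k → count k (x ∷ r) ≡ suc (count k r)
count-∷-≡ {k} {x} r eq = cong length (filter-accept (λ x → T? (x ≡ᵇ k)) {x} {r} (≡⇒≡ᵇ x k eq))

count-∷-≢ : ∀ {k x} r → x ≢ k → count k (x ∷ r) ≡ count k r
count-∷-≢ {k} {x} r ne = cong length (filter-reject (λ x → T? (x ≡ᵇ k)) {x} {r} λ t → ne (≡ᵇ⇒≡ x k t))

count≤length : ∀ k r → count k r ≤ length r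
count≤length k r = length-filter _ r

count-++ : ∀ k r s → count k (r ++ s) ≡ count k r + count k s
count-++ k r s = trans (cong length (filter-++ (λ x → T? (x ≡ᵇ k)) r s)) (length-++ (filter _ r))

count-∉ : ∀ {k} r → (∀ c → c < length r → r ! c ≢ k) → count k r ≡ 0
count-∉ []      h = refl
count-∉ (x ∷ r) h = trans (count-∷-≢ r (h 0 z<s)) (count-∉ r λ c c< → h (suc c) (s<s c<))

count-const : ∀ {k} r → (∀ c → c < length r → r ! c ≡ k) → count k r ≡ length r
count-const []      h = refl
count-const (x ∷ r) h = trans (count-∷-≡ r (h 0 z<s)) (cong suc (count-const r λ c c< → h (suc c) (s<s c<)))

count-full : ∀ {k} r → length r ≤ count k r → ∀ c → c < length r → r ! c ≡ k
count-full {k} (x ∷ r) le c c< with x ≟ k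
... | no ne = contradiction (≤-trans le (≤-trans (≤-reflexive (count-∷-≢ r ne)) (count≤length k r))) (<-irrefl refl)
... | yes eq with c
... | zero   = eq
... | suc c′ = count-full r (s≤s⁻¹ (≤-trans le (≤-reflexive (count-∷-≡ r eq)))) c′ (s<s⁻¹ c<)

count-∈ : ∀ {k} r {c} → c < length r → r ! c ≡ k → 0 < count k r
count-∈ (x ∷ r) {zero}  c< eq = subst (0 <_) (sym (count-∷-≡ r eq)) z<s
count-∈ {k} (x ∷ r) {suc c} c< eq with x ≟ k
... | yes p = subst (0 <_) (sym (count-∷-≡ r p)) z<s
... | no p  = subst (0 <_) (sym (count-∷-≢ r p)) (count-∈ r (s<s⁻¹ c<) eq)

count-find : ∀ {k} r → 0 < count k r → ∃ λ c → c < length r × r ! c ≡ k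
count-find {k} (x ∷ r) pos with x ≟ k
... | yes p = 0 , z<s , p
... | no p  = let (c , c< , eq) = count-find r (subst (0 <_) (count-∷-≢ r p) pos) in suc c , s<s c< , eq

count≤countEntry : ∀ {k} T {i} → i < length T → count k (T ‼ i) ≤ countEntry k T
count≤countEntry (r ∷ T) {zero}  i< = m≤m+n _ _
count≤countEntry {k} (r ∷ T) {suc i} i< = ≤-trans (count≤countEntry T (s<s⁻¹ i<)) (m≤n+m _ (count k r))

count+count≤countEntry : ∀ {k} T {i j} → i < j → j < length T →
                         count k (T ‼ i) + count k (T ‼ j) ≤ countEntry k T
count+count≤countEntry {k} (r ∷ T) {zero}  {suc j} i<j j< = +-monoʳ-≤ (count k r) (count≤countEntry T (s<s⁻¹ j<))
count+count≤countEntry {k} (r ∷ T) {suc i} {suc j} i<j j< =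
  ≤-trans (count+count≤countEntry T (s<s⁻¹ i<j) (s<s⁻¹ j<)) (m≤n+m _ (count k r))

_∉Row_ : ℕ → List ℕ → Set
k ∉Row r = ∀ c → c < length r → r ! c ≢ k

countEntry-∉ : ∀ {k} T → (∀ i → i < length T → k ∉Row (T ‼ i)) → countEntry k T ≡ 0
countEntry-∉ []      h = refl
countEntry-∉ (r ∷ T) h = cong₂ _+_ (count-∉ r (h 0 z<s)) (countEntry-∉ T λ i i< → h (suc i) (s<s i<))

countEntry-single : ∀ {k} T {i} → i < length T → (∀ j → j < length T → j ≢ i → k ∉Row (T ‼ j)) →
                    countEntry k T ≡ count k (T ‼ i)
countEntry-single (r ∷ T) {zero}  i< h = trans
  (cong (count _ r +_) (countEntry-∉ T λ j j< → h (suc j) (s<s j<) λ ())) (+-identityʳ _)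
countEntry-single (r ∷ T) {suc i} i< h = cong₂ _+_ (count-∉ r (h 0 z<s λ ()))
  (countEntry-single T (s<s⁻¹ i<) λ j j< ne → h (suc j) (s<s j<) (ne ∘ suc-injective))

countEntry-cell : ∀ {k} T {i c} → i < length T → c < length (T ‼ i) → T ‼ i ! c ≡ k → 0 < countEntry k T
countEntry-cell T {i} i< c< eq = ≤-trans (count-∈ (T ‼ i) c< eq) (count≤countEntry T i<)

-- Fillings given by entry functions

tableau : List ℕ → (ℕ → ℕ → ℕ) → List (List ℕ)
tableau a E = applyUpTo (λ i → applyUpTo (E i) (a ! i)) (length a)

applyUpTo-! : ∀ xs → applyUpTo (xs !_) (length xs) ≡ xs
applyUpTo-! []       = refl
applyUpTo-! (x ∷ xs) = cong (x ∷_) (applyUpTo-! xs)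

applyUpTo-‼ : ∀ T → applyUpTo (T ‼_) (length T) ≡ T
applyUpTo-‼ []      = refl
applyUpTo-‼ (r ∷ T) = cong (r ∷_) (applyUpTo-‼ T)

applyUpTo-cong : ∀ {A : Set} {f g : ℕ → A} n → (∀ i → i < n → f i ≡ g i) → applyUpTo f n ≡ applyUpTo g n
applyUpTo-cong zero    h = refl
applyUpTo-cong (suc n) h = cong₂ _∷_ (h 0 z<s) (applyUpTo-cong n λ i i< → h (suc i) (s<s i<))

tableau-shape : ∀ a E → map length (tableau a E) ≡ a
tableau-shape a E = trans (map-applyUpTo _ length (length a))
  (trans (applyUpTo-cong (length a) λ i _ → length-applyUpTo (E i) (a ! i)) (applyUpTo-! a))

tableau-row : ∀ a E {i} → i < length a → tableau a E ‼ i ≡ applyUpTo (E i) (a ! i)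
tableau-row a E = ‼-applyUpTo (λ i → applyUpTo (E i) (a ! i))

tableau-cell : ∀ a E {i c} → i < length a → c < a ! i → tableau a E ‼ i ! c ≡ E i c
tableau-cell a E {i} {c} i< c< = trans (cong (_! c) (tableau-row a E i<)) (!-applyUpTo (E i) c<)

module _ {a T} (F : Filling a T) where

  row-length : ∀ i → length (T ‼ i) ≡ a ! i
  row-length i = trans (sym (!-map-length T i)) (cong (_! i) (shape F))

  rows-length : length T ≡ length a
  rows-length = trans (sym (length-map length T)) (cong length (shape F))

  private
    i< : ∀ {i} → i < length a → i < length T
    i< = subst (_ <_) (sym rows-length)

    c< : ∀ {i c} → c < a ! i → c < length (T ‼ i)
    c< {i} = subst (_ <_) (sym (row-length i))

  cell-decreasing : ∀ {i c} → i < length a → suc c < a ! i → T ‼ i ! suc c ≤ T ‼ i ! c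
  cell-decreasing p q = decreasing (valid F) _ (i< p) _ (c< q)

  cell-≥1 : ∀ {i c} → i < length a → c < a ! i → 1 ≤ T ‼ i ! c
  cell-≥1 p q = proj₁ (bounded (valid F) _ (i< p) _ (c< q))

  cell-≤ : ∀ {i c} → i < length a → c < a ! i → T ‼ i ! c ≤ suc i
  cell-≤ p q = proj₂ (bounded (valid F) _ (i< p) _ (c< q))

  cell-first : ∀ {i j} → i < j → j < length a → 0 < a ! i → 0 < a ! j → T ‼ i ! 0 < T ‼ j ! 0
  cell-first p q r s = first-increasing (compatible (valid F) _ _ p (i< q)) (c< r) (c< s)

  cell-distinct : ∀ {i j c} → i < j → j < length a → c < a ! i → c < a ! j → T ‼ i ! c ≢ T ‼ j ! c
  cell-distinct p q r s = distinct (compatible (valid F) _ _ p (i< q)) _ (c< r) (c< s)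

  cell-typeB : ∀ {i j c} → i < j → j < length a → c < a ! i → suc c < a ! j → a ! i < a ! j →
               ¬ (T ‼ i ! c ≤ T ‼ j ! c × T ‼ j ! suc c ≤ T ‼ i ! c)
  cell-typeB {i} {j} p q r s t = typeB (compatible (valid F) _ _ p (i< q)) _ (c< r) (c< s)
    (subst₂ _<_ (sym (row-length i)) (sym (row-length j)) t)

  row-antitone : ∀ {i c d} → i < length a → c ≤ d → d < a ! i → T ‼ i ! d ≤ T ‼ i ! c
  row-antitone {c = c} {d} p c≤d d< = go (≤⇒≤′ c≤d) d<
    where
    go : ∀ {d} → c ≤′ d → d < a ! _ → T ‼ _ ! d ≤ T ‼ _ ! c
    go ≤′-refl     d< = ≤-refl
    go (≤′-step q) d< = ≤-trans (cell-decreasing p d<) (go q (<⇒≤ d<))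

module _ {a : List ℕ} {E : ℕ → ℕ → ℕ}
  (dec : ∀ {i c} → i < length a → suc c < a ! i → E i (suc c) ≤ E i c)
  (bnd : ∀ {i c} → i < length a → c < a ! i → 1 ≤ E i c × E i c ≤ suc i)
  (fst : ∀ {i j} → i < j → j < length a → 0 < a ! i → 0 < a ! j → E i 0 < E j 0)
  (dst : ∀ {i j c} → i < j → j < length a → c < a ! i → c < a ! j → E i c ≢ E j c)
  (tyA : ∀ {i j c} → i < j → j < length a → suc c < a ! i → suc c < a ! j → a ! j ≤ a ! i →
         ¬ (E j (suc c) ≤ E i c × E i (suc c) ≤ E j (suc c)))
  (tyB : ∀ {i j c} → i < j → j < length a → c < a ! i → suc c < a ! j → a ! i < a ! j →
         ¬ (E i c ≤ E j c × E j (suc c) ≤ E i c))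
  where

  private
    n = length a

    n< : ∀ {i} → i < length (tableau a E) → i < n
    n< = subst (_ <_) (length-applyUpTo _ n)

    l< : ∀ {i c} → c < length (applyUpTo (E i) (a ! i)) → c < a ! i
    l< {i} = subst (_ <_) (length-applyUpTo (E i) (a ! i))

    lenE : ∀ i → length (applyUpTo (E i) (a ! i)) ≡ a ! i
    lenE i = length-applyUpTo (E i) (a ! i)

    E! : ∀ i {c} → c < a ! i → applyUpTo (E i) (a ! i) ! c ≡ E i c
    E! i = !-applyUpTo (E i)

  tableau-filling : Filling a (tableau a E)
  tableau-filling = record { shape = tableau-shape a E ; valid = record
    { decreasing = λ i i< → subst Decreasing (sym (tableau-row a E (n< i<))) λ c c< →
        subst₂ _≤_ (sym (E! i (l< c<))) (sym (E! i (<⇒≤ (l< c<)))) (dec (n< i<) (l< c<))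
    ; bounded = λ i i< → subst (Within (suc i)) (sym (tableau-row a E (n< i<))) λ c c< →
        subst (λ x → 1 ≤ x × x ≤ suc i) (sym (E! i (l< c<))) (bnd (n< i<) (l< c<))
    ; compatible = λ i j i<j j< → let q = n< j< in
        subst₂ Compatible (sym (tableau-row a E (<-trans i<j q))) (sym (tableau-row a E q)) record
          { first-increasing = λ r s →
              subst₂ _<_ (sym (E! i (l< r))) (sym (E! j (l< s))) (fst i<j q (l< r) (l< s))
          ; distinct = λ c r s →
              subst₂ _≢_ (sym (E! i (l< r))) (sym (E! j (l< s))) (dst i<j q (l< r) (l< s))
          ; typeA = λ c r s le (u , v) → tyA i<j q (l< r) (l< s) (subst₂ _≤_ (lenE j) (lenE i) le)
              (subst₂ _≤_ (E! j (l< s)) (E! i (<⇒≤ (l< r))) u , subst₂ _≤_ (E! i (l< r)) (E! j (l< s)) v)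
          ; typeB = λ c r s lt (u , v) → tyB i<j q (l< r) (l< s) (subst₂ _<_ (lenE i) (lenE j) lt)
              (subst₂ _≤_ (E! i (l< r)) (E! j (<⇒≤ (l< s))) u , subst₂ _≤_ (E! j (l< s)) (E! i (l< r)) v)
          }
    } }

-- Taking j outside the range of rows gives constant rows.
module Perturbed (a : List ℕ) (f : ℕ → ℕ) (j v : ℕ) where

  entry : ℕ → ℕ → ℕ
  entry i c with i ≟ j | suc c ≟ a ! j
  ... | yes _ | yes _ = v
  ... | yes _ | no _  = f i
  ... | no _  | _     = f i

  entry-cases : ∀ i c → (entry i c ≡ f i) ⊎ (i ≡ j × suc c ≡ a ! j × entry i c ≡ v)
  entry-cases i c with i ≟ j | suc c ≟ a ! j
  ... | yes p | yes q = inj₂ (p , q , refl)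
  ... | yes _ | no _  = inj₁ refl
  ... | no _  | _     = inj₁ refl

  entry-other : ∀ {i} c → i ≢ j → entry i c ≡ f i
  entry-other {i} c i≢j with entry-cases i c
  ... | inj₁ p             = p
  ... | inj₂ (refl , _)    = contradiction refl i≢j

  entry-inner : ∀ {i c} → suc c < a ! i → entry i c ≡ f i
  entry-inner {i} {c} lt with entry-cases i c
  ... | inj₁ p             = p
  ... | inj₂ (refl , e , _) = contradiction e (<⇒≢ lt)

  entry-last : ∀ {c} → suc c ≡ a ! j → entry j c ≡ v
  entry-last {c} e with j ≟ j | suc c ≟ a ! j
  ... | yes _ | yes _ = refl
  ... | yes _ | no ne = contradiction e ne
  ... | no ne | _     = contradiction refl ne

  -- Each hypothesis guards the changed cell. By `change` it is not in the first column and only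
  -- gets smaller. By `avoid` it differs from every row reaching its column, which also settles the
  -- type A triples. A type B triple in which it is the right-hand cell needs a lower row that is
  -- shorter than row j and reaches the last column but one, hence is exactly one cell shorter: this
  -- is `below`.
  module _
    (mono   : ∀ i k → i < k → k < length a → 0 < a ! i → 0 < a ! k → f i < f k)
    (bound  : ∀ i → i < length a → 0 < a ! i → 1 ≤ f i × f i ≤ suc i)
    (change : j < length a → 2 ≤ a ! j × 1 ≤ v × v < f j)
    (avoid  : ∀ i → i < length a → j < length a → i ≢ j → a ! j ≤ a ! i → v ≢ f i)
    (below  : ∀ i → i < j → j < length a → suc (a ! i) ≡ a ! j → f i < v)
    where

    entry≤ : ∀ {i} c → i < length a → entry i c ≤ f i
    entry≤ {i} c i< with entry-cases i c
    ... | inj₁ p               = ≤-reflexive p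
    ... | inj₂ (refl , _ , p) = ≤-trans (≤-reflexive p) (<⇒≤ (proj₂ (proj₂ (change i<))))

    private
      pos : ∀ {m n} → m < n → 0 < n
      pos = ≤-trans (s≤s z≤n)

    filling : Filling a (tableau a entry)
    filling = tableau-filling
      (λ {i} {c} i< c< → subst (entry i (suc c) ≤_) (sym (entry-inner c<)) (entry≤ (suc c) i<))
      bnd
      (λ {i} {k} i<k k< p q → subst₂ _<_ (sym (first i (<-trans i<k k<))) (sym (first k k<)) (mono i k i<k k< p q))
      dst tyA tyB
      where
      bnd : ∀ {i c} → i < length a → c < a ! i → 1 ≤ entry i c × entry i c ≤ suc i
      bnd {i} {c} i< c< with entry-cases i c
      ... | inj₁ p rewrite p = bound i i< (pos c<)
      ... | inj₂ (refl , _ , p) rewrite p = let (_ , q , r) = change i< in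
        q , ≤-trans (<⇒≤ r) (proj₂ (bound i i< (pos c<)))

      first : ∀ i → i < length a → entry i 0 ≡ f i
      first i i< with entry-cases i 0
      ... | inj₁ p               = p
      ... | inj₂ (refl , e , _) = contradiction (subst (2 ≤_) (sym e) (proj₁ (change i<))) (<-irrefl refl)

      dst : ∀ {i k c} → i < k → k < length a → c < a ! i → c < a ! k → entry i c ≢ entry k c
      dst {i} {k} {c} i<k k< p q e with entry-cases i c | entry-cases k c
      ... | inj₁ u | inj₁ w = <⇒≢ (mono i k i<k k< (pos p) (pos q)) (trans (sym u) (trans e w))
      ... | inj₁ u | inj₂ (refl , s , w) =
        avoid i (<-trans i<k k<) k< (<⇒≢ i<k) (subst (_≤ a ! i) s p) (trans (sym w) (trans (sym e) u))
      ... | inj₂ (refl , s , u) | inj₁ w =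
        avoid k k< (<-trans i<k k<) (≢-sym (<⇒≢ i<k)) (subst (_≤ a ! k) s q) (trans (sym u) (trans e w))
      ... | inj₂ (refl , _) | inj₂ (refl , _) = <-irrefl refl i<k

      tyA : ∀ {i k c} → i < k → k < length a → suc c < a ! i → suc c < a ! k → a ! k ≤ a ! i →
            ¬ (entry k (suc c) ≤ entry i c × entry i (suc c) ≤ entry k (suc c))
      tyA {i} {k} {c} i<k k< p q le (u , w) with entry-cases k (suc c)
      ... | inj₁ e = <⇒≱ (mono i k i<k k< (pos p) (pos q))
        (≤-trans (≤-reflexive (sym e)) (≤-trans u (entry≤ c (<-trans i<k k<))))
      ... | inj₂ (refl , s , e) = avoid i (<-trans i<k k<) k< (<⇒≢ i<k) le
        (≤-antisym (subst₂ _≤_ e (entry-other c (<⇒≢ i<k)) u)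
                   (subst₂ _≤_ (entry-other (suc c) (<⇒≢ i<k)) e w))

      tyB : ∀ {i k c} → i < k → k < length a → c < a ! i → suc c < a ! k → a ! i < a ! k →
            ¬ (entry i c ≤ entry k c × entry k (suc c) ≤ entry i c)
      tyB {i} {k} {c} i<k k< p q lt (_ , w) with entry-cases k (suc c)
      ... | inj₁ e = <⇒≱ (mono i k i<k k< (pos p) (pos q))
        (≤-trans (≤-reflexive (sym e)) (≤-trans w (entry≤ c (<-trans i<k k<))))
      ... | inj₂ (refl , s , e) = <⇒≱
        (below i i<k k< (trans (cong suc (≤-antisym (s≤s⁻¹ (subst (a ! i <_) (sym s) lt)) p)) s))
        (≤-trans (≤-reflexive (sym e)) (≤-trans w (entry≤ c (<-trans i<k k<))))

-- Finite sums

sumTo : (ℕ → ℕ) → ℕ → ℕ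
sumTo f zero    = 0
sumTo f (suc n) = f 0 + sumTo (f ∘ suc) n

sumTo-cong : ∀ {f g} n → (∀ i → i < n → f i ≡ g i) → sumTo f n ≡ sumTo g n
sumTo-cong zero    h = refl
sumTo-cong (suc n) h = cong₂ _+_ (h 0 z<s) (sumTo-cong n λ i i< → h (suc i) (s<s i<))

sumTo-mono : ∀ {f g} n → (∀ i → i < n → f i ≤ g i) → sumTo f n ≤ sumTo g n
sumTo-mono zero    h = z≤n
sumTo-mono (suc n) h = +-mono-≤ (h 0 z<s) (sumTo-mono n λ i i< → h (suc i) (s<s i<))

sumTo-mono-< : ∀ {f g} n {k} → (∀ i → i < n → f i ≤ g i) → k < n → f k < g k → sumTo f n < sumTo g n
sumTo-mono-< (suc n) {zero}  h k< lt = +-mono-<-≤ lt (sumTo-mono n λ i i< → h (suc i) (s<s i<))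
sumTo-mono-< (suc n) {suc k} h k< lt = +-mono-≤-< (h 0 z<s) (sumTo-mono-< n (λ i i< → h (suc i) (s<s i<)) (s<s⁻¹ k<) lt)

+-interchange : ∀ a b c d → (a + b) + (c + d) ≡ (a + c) + (b + d)
+-interchange = solve-∀

sumTo-+ : ∀ f g n → sumTo (λ i → f i + g i) n ≡ sumTo f n + sumTo g n
sumTo-+ f g zero    = refl
sumTo-+ f g (suc n) = trans (cong (f 0 + g 0 +_) (sumTo-+ (f ∘ suc) (g ∘ suc) n)) (+-interchange (f 0) (g 0) _ _)

sumTo-zero : ∀ n → sumTo (λ _ → 0) n ≡ 0
sumTo-zero zero    = refl
sumTo-zero (suc n) = sumTo-zero n

sumTo-last : ∀ f n → sumTo f (suc n) ≡ sumTo f n + f n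
sumTo-last f zero    = +-comm (f 0) 0
sumTo-last f (suc n) = trans (cong (f 0 +_) (sumTo-last (f ∘ suc) n)) (sym (+-assoc (f 0) _ _))

sumTo-reverse : ∀ {f g} n → (∀ i j → i + suc j ≡ n → f i ≡ g j) → sumTo f n ≡ sumTo g n
sumTo-reverse zero    h = refl
sumTo-reverse {f} {g} (suc n) h = trans
  (cong₂ _+_ (h 0 n refl) (sumTo-reverse n λ i j e → h (suc i) j (cong suc e)))
  (trans (+-comm (g n) _) (sym (sumTo-last g n)))

sumTo-suc : ∀ {f g} n {k} → k < n → f k ≡ suc (g k) → (∀ i → i ≢ k → f i ≡ g i) → sumTo f n ≡ suc (sumTo g n)
sumTo-suc (suc n) {zero}  k< e h = cong₂ _+_ e (sumTo-cong n λ i _ → h (suc i) λ ())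
sumTo-suc {f} {g} (suc n) {suc k} k< e h = trans
  (cong₂ _+_ (h 0 λ ()) (sumTo-suc n (s<s⁻¹ k<) e λ i ne → h (suc i) (ne ∘ suc-injective)))
  (+-suc (g 0) _)

-- Columns

-- Rows too short to reach column c contribute the default 0. This is why occurrences in columns are
-- counted for values `suc k` only.
column : ℕ → List (List ℕ) → List ℕ
column c = map (_! c)

!-positive : ∀ {k} r c → r ! c ≡ suc k → c < length r
!-positive (x ∷ r) zero    e = z<s
!-positive (x ∷ r) (suc c) e = s<s (!-positive r c e)

drop-!0 : ∀ c r → drop c r ! 0 ≡ r ! c
drop-!0 zero    r       = refl
drop-!0 (suc c) []      = refl
drop-!0 (suc c) (x ∷ r) = drop-!0 c r

count-take-suc : ∀ k c r → count (suc k) (take (suc c) r) ≡ count (suc k) (r ! c ∷ []) + count (suc k) (take c r)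
count-take-suc k zero    []      = refl
count-take-suc k (suc c) []      = refl
count-take-suc k zero    (x ∷ r) = sym (+-identityʳ _)
count-take-suc k (suc c) (x ∷ r) with x ≟ suc k
... | yes p = trans (count-∷-≡ _ p) (trans (cong suc (count-take-suc k c r))
                (trans (sym (+-suc (count (suc k) (r ! c ∷ [])) _))
                  (cong (count (suc k) (r ! c ∷ []) +_) (sym (count-∷-≡ _ p)))))
... | no p  = trans (count-∷-≢ _ p) (trans (count-take-suc k c r)
                (cong (count (suc k) (r ! c ∷ []) +_) (sym (count-∷-≢ _ p))))

count-∷ : ∀ k x r → count k (x ∷ r) ≡ count k (x ∷ []) + count k r
count-∷ k x r = count-++ k (x ∷ []) r

countEntry-take-suc : ∀ k c T → countEntry (suc k) (map (take (suc c)) T) ≡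
                      count (suc k) (column c T) + countEntry (suc k) (map (take c) T)
countEntry-take-suc k c []      = refl
countEntry-take-suc k c (r ∷ T) = trans
  (cong₂ _+_ (count-take-suc k c r) (countEntry-take-suc k c T))
  (trans (+-interchange (count (suc k) (r ! c ∷ [])) _ _ _)
         (cong (_+ (count (suc k) (take c r) + countEntry (suc k) (map (take c) T)))
           (sym (count-∷ (suc k) (r ! c) (column c T)))))

countEntry-take-drop : ∀ k c T → countEntry k T ≡ countEntry k (map (take c) T) + countEntry k (map (drop c) T)
countEntry-take-drop k c []      = refl
countEntry-take-drop k c (r ∷ T) = trans
  (cong₂ _+_ (trans (cong (count k) (sym (take++drop≡id c r))) (count-++ k (take c r) (drop c r)))
    (countEntry-take-drop k c T))
  (+-interchange (count k (take c r)) _ _ _)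

count-column-∉ : ∀ {k} c T → (∀ i → i < length T → T ‼ i ! c ≢ k) → count k (column c T) ≡ 0
count-column-∉ c []      h = refl
count-column-∉ c (r ∷ T) h = trans (count-∷-≢ _ (h 0 z<s)) (count-column-∉ c T λ i i< → h (suc i) (s<s i<))

count-column-find : ∀ {k} c T → 0 < count k (column c T) → ∃ λ i → i < length T × T ‼ i ! c ≡ k
count-column-find {k} c (r ∷ T) p with r ! c ≟ k
... | yes e = 0 , z<s , e
... | no ne = let (i , i< , e) = count-column-find c T (subst (0 <_) (count-∷-≢ _ ne) p) in suc i , s<s i< , e

count-column≤1 : ∀ {k} c T → (∀ i j → i < j → j < length T → T ‼ i ! c ≡ k → T ‼ j ! c ≢ k) →
                 count k (column c T) ≤ 1
count-column≤1 c []      h = z≤n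
count-column≤1 {k} c (r ∷ T) h with r ! c ≟ k
... | yes p = ≤-reflexive (trans (count-∷-≡ _ p)
                (cong suc (count-column-∉ c T λ i i< → h 0 (suc i) z<s (s<s i<) p)))
... | no p  = ≤-trans (≤-reflexive (count-∷-≢ _ p))
                (count-column≤1 c T λ i j i<j j< → h (suc i) (suc j) (s<s i<j) (s<s j<))

sumTo-count : ∀ n r → All (λ x → 1 ≤ x × x ≤ n) r → sumTo (λ k → count (suc k) r) n ≡ length r
sumTo-count n []          []               = sumTo-zero n
sumTo-count n (suc x ∷ r) ((_ , x<n) ∷ h) = trans
  (sumTo-suc n x<n (count-∷-≡ {suc x} r refl) λ i ne → count-∷-≢ r (ne ∘ sym ∘ suc-injective))
  (cong suc (sumTo-count n r h))

sumTo-countEntry : ∀ n T → All (All (λ x → 1 ≤ x × x ≤ n)) T →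
                   sumTo (λ k → countEntry (suc k) T) n ≡ sumTo (λ i → length (T ‼ i)) (length T)
sumTo-countEntry n []      []      = sumTo-zero n
sumTo-countEntry n (r ∷ T) (h ∷ hs) = trans (sumTo-+ _ _ n) (cong₂ _+_ (sumTo-count n r h) (sumTo-countEntry n T hs))

All-! : ∀ {P : ℕ → Set} r → (∀ c → c < length r → P (r ! c)) → All P r
All-! []      h = []
All-! (x ∷ r) h = h 0 z<s ∷ All-! r λ c c< → h (suc c) (s<s c<)

All-‼ : ∀ {P : List ℕ → Set} T → (∀ i → i < length T → P (T ‼ i)) → All P T
All-‼ []      h = []
All-‼ (r ∷ T) h = h 0 z<s ∷ All-‼ T λ i i< → h (suc i) (s<s i<)

map-‼ : ∀ (g : List ℕ → List ℕ) T {i} → i < length T → map g T ‼ i ≡ g (T ‼ i)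
map-‼ g (r ∷ T) {zero}  i< = refl
map-‼ g (r ∷ T) {suc i} i< = map-‼ g T (s<s⁻¹ i<)

-- A value occurs at most c times in the first c columns, so its number of occurrences
-- exceeds c by at most the number of occurrences further right.
module Excess {a T} (F : Filling a T) where

  private
    n = length a

  column≤1 : ∀ k c → count (suc k) (column c T) ≤ 1
  column≤1 k c = count-column≤1 c T λ i j i<j j< p q →
    distinct (compatible (valid F) i j i<j j<) c (!-positive (T ‼ i) c p) (!-positive (T ‼ j) c q) (trans p (sym q))

  take≤ : ∀ k c → countEntry (suc k) (map (take c) T) ≤ c
  take≤ k zero    = ≤-reflexive (countEntry-∉ (map (take 0) T) λ i i< c c< → contradiction
    (subst (λ r → c < length r) (map-‼ (take 0) T (subst (i <_) (length-map _ T) i<)) c<) λ ())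
  take≤ k (suc c) = ≤-trans (≤-reflexive (countEntry-take-suc k c T)) (+-mono-≤ (column≤1 k c) (take≤ k c))

  take-missing : ∀ k c → count (suc k) (column c T) ≡ 0 → countEntry (suc k) (map (take (suc c)) T) ≤ c
  take-missing k c e = ≤-trans (≤-reflexive (trans (countEntry-take-suc k c T)
    (cong (_+ countEntry (suc k) (map (take c) T)) e))) (take≤ k c)

  sumTo-drop : ∀ c → sumTo (λ k → countEntry (suc k) (map (drop c) T)) n ≡ sumTo (λ i → a ! i ∸ c) n
  sumTo-drop c = trans
    (sumTo-countEntry n (map (drop c) T) (All.map⁺ (All-‼ T λ i i< → All.drop⁺ c (All-! (T ‼ i) λ d d< →
      let (p , q) = bounded (valid F) i i< d d< in p , ≤-trans q (subst (i <_) (rows-length F) i<)))))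
    (trans (cong (sumTo _) (trans (length-map (drop c) T) (rows-length F)))
      (sumTo-cong n λ i i< → trans (cong length (map-‼ (drop c) T (subst (i <_) (sym (rows-length F)) i<)))
        (trans (length-drop c (T ‼ i)) (cong (_∸ c) (row-length F i)))))

  excess≤ : ∀ k c → countEntry (suc k) T ∸ c ≤ countEntry (suc k) (map (drop c) T)
  excess≤ k c rewrite countEntry-take-drop (suc k) c T =
    ≤-trans (∸-monoˡ-≤ c (+-monoˡ-≤ _ (take≤ k c))) (≤-reflexive (m+n∸m≡n c _))

  excess : ∀ c → sumTo (λ k → countEntry (suc k) T ∸ c) n ≤ sumTo (λ i → a ! i ∸ c) n
  excess c = ≤-trans (sumTo-mono n λ k _ → excess≤ k c) (≤-reflexive (sumTo-drop c))

  -- A value that misses column c occurs at most c times in the first c+1 columns. This slack of one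
  -- makes the estimate for that value strict, because the value does occur further right, namely in
  -- column c+1.
  excess-< : ∀ {i c k} → i < n → suc c < a ! i → T ‼ i ! suc c ≡ suc k → count (suc k) (column c T) ≡ 0 →
             sumTo (λ k → countEntry (suc k) T ∸ suc c) n < sumTo (λ i → a ! i ∸ suc c) n
  excess-< {i} {c} {k} i< c< e miss = ≤-trans
    (sumTo-mono-< n (λ k _ → excess≤ k (suc c)) (≤-trans (≤-reflexive (sym e)) (≤-trans (cell-≤ F i< c<) i<)) strict)
    (≤-reflexive (sumTo-drop (suc c)))
    where
    i<T = subst (i <_) (sym (rows-length F)) i<
    row≡ = map-‼ (drop (suc c)) T i<T

    D = countEntry (suc k) (map (drop (suc c)) T)

    D>0 : 0 < D
    D>0 = countEntry-cell (map (drop (suc c)) T) {i} {0} (subst (i <_) (sym (length-map _ T)) i<T)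
      (subst (0 <_) (sym (trans (cong length row≡) (length-drop (suc c) (T ‼ i))))
        (m<n⇒0<n∸m (subst (suc c <_) (sym (row-length F i)) c<)))
      (trans (cong (_! 0) row≡) (trans (drop-!0 (suc c) (T ‼ i)) e))

    lemma : ∀ c {D} → 0 < D → (c + D) ∸ suc c < D
    lemma zero    {suc D} p = ≤-refl
    lemma (suc c) p = lemma c p

    strict : countEntry (suc k) T ∸ suc c < D
    strict rewrite countEntry-take-drop (suc k) (suc c) T =
      ≤-<-trans (∸-monoˡ-≤ (suc c) (+-monoˡ-≤ D (take-missing k c miss))) (lemma c D>0)

-- The positions of the zero parts

-- The number of nonzero parts before position i; at `length a` it is the number of all nonzero
-- parts.
rank : List ℕ → ℕ → ℕ
rank []          i       = 0
rank (x ∷ a)     zero    = 0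
rank (zero ∷ a)  (suc i) = rank a i
rank (suc _ ∷ a) (suc i) = suc (rank a i)

rank≤ : ∀ a i → rank a i ≤ i
rank≤ []          i       = z≤n
rank≤ (x ∷ a)     zero    = z≤n
rank≤ (zero ∷ a)  (suc i) = m≤n⇒m≤1+n (rank≤ a i)
rank≤ (suc _ ∷ a) (suc i) = s≤s (rank≤ a i)

rank-mono-< : ∀ a {i k} → i < k → 0 < a ! i → rank a i < rank a k
rank-mono-< (suc x ∷ a) {zero}  {suc k} i<k p = z<s
rank-mono-< (zero ∷ a)  {suc i} {suc k} i<k p = rank-mono-< a (s<s⁻¹ i<k) p
rank-mono-< (suc x ∷ a) {suc i} {suc k} i<k p = s<s (rank-mono-< a (s<s⁻¹ i<k) p)

rank-zeros : ∀ a z → z ≤ length a → (∀ i → i < z → a ! i ≡ 0) → rank a (length a) + z ≤ length a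
rank-zeros a zero _ h = ≤-trans (≤-reflexive (+-identityʳ _)) (rank≤ a (length a))
rank-zeros (x ∷ a) (suc z) le h with refl ← h 0 z<s = ≤-trans (≤-reflexive (+-suc _ z))
  (s≤s (rank-zeros a z (s≤s⁻¹ le) λ i i< → h (suc i) (s<s i<)))

rank-full : ∀ a → rank a (length a) ≡ length a → ∀ i → i < length a → 0 < a ! i
rank-full (zero ∷ a)  e i       i< = contradiction (≤-trans (≤-reflexive (sym e)) (rank≤ a (length a))) (<-irrefl refl)
rank-full (suc x ∷ a) e zero    i< = z<s
rank-full (suc x ∷ a) e (suc i) i< = rank-full a (suc-injective e) i (s<s⁻¹ i<)

rank-positive : ∀ a z → (∀ i → i < z → a ! i ≡ 0) → rank a (length a) + z ≡ length a →
                ∀ i → z ≤ i → i < length a → 0 < a ! i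
rank-positive a zero h e i _ i< = rank-full a (trans (sym (+-identityʳ _)) e) i i<
rank-positive (x ∷ a) (suc z) h e (suc i) z≤ i< with refl ← h 0 z<s =
  rank-positive a z (λ i i< → h (suc i) (s<s i<)) (suc-injective (trans (sym (+-suc _ z)) e)) i (s≤s⁻¹ z≤) (s<s⁻¹ i<)

module ConstantRows (a : List ℕ) (f : ℕ → ℕ)
  (mono  : ∀ i k → i < k → k < length a → 0 < a ! i → 0 < a ! k → f i < f k)
  (bound : ∀ i → i < length a → 0 < a ! i → 1 ≤ f i × f i ≤ suc i) where

  private
    absurd : ∀ {A : Set} → length a < length a → A
    absurd lt = contradiction lt (<-irrefl refl)

    module P = Perturbed a f (length a) 0

  open P public using (entry)

  filling : Filling a (tableau a entry)
  filling = P.filling mono bound absurd (λ _ _ → absurd) (λ _ _ → absurd)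

  cell : ∀ {i c} → i < length a → c < a ! i → tableau a entry ‼ i ! c ≡ f i
  cell i< c< = trans (tableau-cell a entry i< c<) (P.entry-other _ (<⇒≢ i<))

module _ {a T} (F : Filling a T) where

  count-row≤ : ∀ k i → count k (T ‼ i) ≤ a ! i
  count-row≤ k i = ≤-trans (count≤length k (T ‼ i)) (≤-reflexive (row-length F i))

  row-constant : ∀ {k i} → (∀ c → c < a ! i → T ‼ i ! c ≡ k) → count k (T ‼ i) ≡ a ! i
  row-constant {i = i} h = trans (count-const (T ‼ i) λ c c< → h c (subst (c <_) (row-length F i) c<)) (row-length F i)

  countEntry-row : ∀ {k i} → i < length a → (∀ c → c < a ! i → T ‼ i ! c ≡ k) → a ! i ≤ countEntry k T
  countEntry-row i< h = ≤-trans (≤-reflexive (sym (row-constant h)))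
    (count≤countEntry T (subst (_ <_) (sym (rows-length F)) i<))

  countEntry-only : ∀ {k i} → i < length a → (∀ j → j < length a → j ≢ i → ∀ c → c < a ! j → T ‼ j ! c ≢ k) →
                    countEntry k T ≡ count k (T ‼ i)
  countEntry-only i< h = countEntry-single T (subst (_ <_) (sym (rows-length F)) i<)
    λ j j< ne c c< → h j (subst (j <_) (rows-length F) j<) ne c (subst (c <_) (row-length F j) c<)

  -- If the largest values k occur (at least) a_k times, they fill up their own rows.
  top-count : ∀ d t → t < length a → length a ≤ t + d →
    (∀ k → t < k → k < length a → a ! k ≤ countEntry (suc k) T) →
    countEntry (suc t) T ≡ count (suc t) (T ‼ t)
  top-cells : ∀ d t → t < length a → length a ≤ t + d →
    (∀ k → t ≤ k → k < length a → a ! k ≤ countEntry (suc k) T) →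
    ∀ c → c < a ! t → T ‼ t ! c ≡ suc t

  top-count zero    t t< le h = contradiction (≤-trans t< (≤-trans le (≤-reflexive (+-identityʳ t)))) (<-irrefl refl)
  top-count (suc d) t t< le h = countEntry-only t< other
    where
    other : ∀ j → j < length a → j ≢ t → ∀ c → c < a ! j → T ‼ j ! c ≢ suc t
    other j j< ne c c< e with <-cmp j t
    ... | tri< j<t _ _ = <⇒≱ j<t (s≤s⁻¹ (≤-trans (≤-reflexive (sym e)) (cell-≤ F j< c<)))
    ... | tri≈ _ j≡t _ = ne j≡t
    ... | tri> _ _ t<j = ne (suc-injective (trans (sym
      (top-cells d j j< (≤-trans le (≤-trans (≤-reflexive (+-suc t d)) (+-monoˡ-≤ d t<j)))
        (λ k j≤k → h k (<-≤-trans t<j j≤k)) c c<)) e))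

  top-cells d t t< le h c c< = count-full (T ‼ t)
    (≤-trans (≤-reflexive (row-length F t)) (≤-trans (h t ≤-refl t<)
      (≤-reflexive (top-count d t t< le λ k t<k → h k (<⇒≤ t<k)))))
    c (subst (c <_) (sym (row-length F t)) c<)

record Dual (n : ℕ) (b A : List ℕ) : Set where
  field
    |b|  : length b ≡ n
    |A|  : length A ≡ n
    to   : Mirrors n A b
    from : Mirrors n b A

Dual-swap : ∀ {n b A} → Dual n b A → Dual n A b
Dual-swap D = record { |b| = |A| ; |A| = |b| ; to = from ; from = to } where open Dual D

-- Pushing the nonzero rows of A down to the entries 1,…,rank A n shows that the entries
-- n+1-rank A n,…,n suffice for a filling of b.
zeros-below : ∀ {n b A} → Dual n b A → ∀ i → i < n → 0 < b ! i → n ≤ i + rank A n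
zeros-below {n} {b} {A} D i i<n pos with refl ← Dual.|b| D = n≤
  where
  open Dual D
  module C = ConstantRows A (λ i → suc (rank A i)) (λ i k i<k _ p _ → s<s (rank-mono-< A i<k p))
    (λ i _ _ → s≤s z≤n , s≤s (rank≤ A i))

  T = tableau A C.entry

  Umir = to T C.filling
  U = proj₁ Umir
  F = proj₁ (proj₂ Umir)
  rev = proj₂ (proj₂ Umir)

  absent : ∀ k → rank A n ≤ k → countEntry (suc k) T ≡ 0
  absent k le = countEntry-∉ T λ j j< c c< e →
    let j<A = subst (j <_) (length-applyUpTo _ (length A)) j<
        c<A = subst (c <_) (row-length C.filling j) c<
        e′ = suc-injective (trans (sym (C.cell j<A c<A)) e)
    in <⇒≱ (rank-mono-< A (subst (j <_) |A| j<A) (≤-<-trans z≤n c<A))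
           (subst (rank A n ≤_) (sym e′) le)

  -- If `suc x` is the first entry of row i of U, then x ≤ i. Its mirror value `suc j` occurs in T,
  -- so j < `rank A n`, while x + suc j = n.
  n≤ : n ≤ i + rank A n
  n≤ with U ‼ i ! 0 in e | cell-≥1 F i<n pos | cell-≤ F i<n pos
  ... | suc x | _ | s≤s x≤i with j , eq ← opposite (≤-<-trans x≤i i<n) = subst (_≤ i + rank A n) eq
    (+-mono-≤ x≤i (≰⇒> λ le → <-irrefl refl (subst (0 <_) (trans (mirror rev x j eq) (absent j le))
      (countEntry-cell U (subst (i <_) (sym (rows-length F)) i<n) (subst (0 <_) (sym (row-length F i)) pos) e))))

record Aligned (q p : ℕ) (b : List ℕ) : Set where
  field
    zeros    : ∀ i → i < q → b ! i ≡ 0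
    positive : ∀ i → i < p → 0 < b ! (q + i)

  support : ∀ {i} → 0 < b ! i → q ≤ i
  support {i} pos with q ≤? i
  ... | yes le = le
  ... | no ≰   = contradiction (subst (0 <_) (zeros i (≰⇒> ≰)) pos) (<-irrefl refl)

  support-split : ∀ {i} → i < q + p → 0 < b ! i → ∃ λ i′ → q + i′ ≡ i × i′ < p
  support-split {i} i< pos = i ∸ q , m+[n∸m]≡n q≤i ,
    +-cancelˡ-< q _ _ (subst (_< q + p) (sym (m+[n∸m]≡n q≤i)) i<)
    where q≤i = support pos

rank-≤-dual : ∀ {n b A} → Dual n b A → rank b n ≤ rank A n
rank-≤-dual {n} {b} {A} D with refl ← Dual.|b| D = ≤-trans
  (m+n≤o⇒m≤o∸n (rank b n) (rank-zeros b (n ∸ rank A n) (m∸n≤m n (rank A n)) zeros))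
  (≤-reflexive (m∸[m∸n]≡n (rank≤ A n)))
  where
  zeros : ∀ i → i < n ∸ rank A n → b ! i ≡ 0
  zeros i i< with b ! i in e
  ... | zero  = refl
  ... | suc _ = contradiction (zeros-below D i (<-≤-trans i< (m∸n≤m n (rank A n))) (subst (0 <_) (sym e) z<s))
    (<⇒≱ (subst (_< n) (+-comm (rank A n) i) (m≤n∸o⇒m+o≤n′ i<)))
    where
    m≤n∸o⇒m+o≤n′ : i < n ∸ rank A n → rank A n + i < n
    m≤n∸o⇒m+o≤n′ lt = subst (suc (rank A n + i) ≤_) (m+[n∸m]≡n (rank≤ A n))
      (subst (_≤ rank A n + (n ∸ rank A n)) (+-suc (rank A n) i) (+-monoʳ-≤ (rank A n) lt))

-- By symmetry b and A have equally many nonzero parts. After its forced leading zeros, b has just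
-- that many positions left, so none of them can be zero.
aligned : ∀ {n b A} → Dual n b A → Aligned (n ∸ rank A n) (rank A n) b
aligned {n} {b} {A} D with refl ← Dual.|b| D = record
  { zeros = zeros
  ; positive = λ i i< → rank-positive b (n ∸ p) zeros
      (trans (cong (_+ (n ∸ p)) (≤-antisym (rank-≤-dual D) (rank-≤-dual (Dual-swap D)))) (m+[n∸m]≡n (rank≤ A n)))
      (n ∸ p + i) (m≤m+n (n ∸ p) i)
      (subst (n ∸ p + i <_) (m∸n+n≡m (rank≤ A n)) (+-monoʳ-< (n ∸ p) i<)) }
  where
  p = rank A n
  zeros : ∀ i → i < n ∸ p → b ! i ≡ 0
  zeros i i< with b ! i in e
  ... | zero  = refl
  ... | suc _ = contradiction (zeros-below D i (<-≤-trans i< (m∸n≤m n p)) (subst (0 <_) (sym e) z<s))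
    (<⇒≱ (subst (i + p <_) (m∸n+n≡m (rank≤ A n)) (+-monoˡ-< p i<)))

-- Comparison of the positive parts

increasing-≤ : ∀ {p} s (g : ℕ → ℕ) → (∀ i → i < p → g i ≤ s + p) →
               (∀ i → suc i < p → g i < g (suc i)) → ∀ i → i < p → g i ≤ suc (s + i)
increasing-≤ {p} s g bnd inc i i< with d , e ← opposite i< = upper d i e
  where
  upper : ∀ d i → i + suc d ≡ p → g i ≤ suc (s + i)
  upper zero    i e = ≤-trans (bnd i (opposite-< 0 (opposite-swap i 0 e)))
    (≤-reflexive (trans (cong (s +_) (trans (sym e) (+-comm i 1))) (+-suc s i)))
  upper (suc d) i e = s≤s⁻¹ (<-≤-trans
    (inc i (opposite-< d (opposite-swap (suc i) d e′)))
    (subst (λ m → g (suc i) ≤ suc m) (+-suc s i) (upper d (suc i) e′)))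
    where e′ = trans (sym (+-suc i (suc d))) e

squeeze : ∀ {p} (g : ℕ → ℕ) → (∀ i → i < p → 1 ≤ g i × g i ≤ p) →
          (∀ i → suc i < p → g i < g (suc i)) → ∀ i → i < p → g i ≡ suc i
squeeze {p} g bnd inc i i< =
  ≤-antisym (increasing-≤ 0 g (λ i i< → proj₂ (bnd i i<)) inc i i<) (lower i i<)
  where
  lower : ∀ i → i < p → suc i ≤ g i
  lower zero    i< = proj₁ (bnd 0 i<)
  lower (suc i) i< = ≤-<-trans (lower i (<⇒≤ i<)) (inc i i<)

-- Symmetric in b and A, with the same q and p for both, so that every consequence can be used a
-- second time with their roles exchanged.
record Situation (n p q : ℕ) (b A : List ℕ) : Set where
  field
    q+p≡n : q + p ≡ n
    dual  : Dual n b A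
    algb  : Aligned q p b
    algA  : Aligned q p A

Situation-swap : ∀ {n p q b A} → Situation n p q b A → Situation n p q A b
Situation-swap S = record { q+p≡n = q+p≡n ; dual = Dual-swap dual ; algb = algA ; algA = algb }
  where open Situation S

situation : ∀ {n b A} → Dual n b A → Situation n (rank A n) (n ∸ rank A n) b A
situation {n} {b} {A} D = record
  { q+p≡n = m∸n+n≡m (rank≤ A n)
  ; dual  = D
  ; algb  = aligned D
  ; algA  = subst (λ p → Aligned (n ∸ p) p A)
      (≤-antisym (rank-≤-dual D) (rank-≤-dual (Dual-swap D))) (aligned (Dual-swap D)) }

module Diagonal (a : List ℕ) where

  open ConstantRows a suc (λ _ _ i<k _ _ _ → s<s i<k) (λ _ _ _ → s≤s z≤n , ≤-refl) public

  contents : ∀ k → k < length a → countEntry (suc k) (tableau a entry) ≡ a ! k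
  contents k k< = trans
    (countEntry-only filling k< λ j j< ne c c< e → ne (suc-injective (trans (sym (cell j< c<)) e)))
    (row-constant filling λ c c< → cell k< c<)

-- The parts of b agree with the reversed parts of A: the mirror image of the filling of A
-- by its row numbers is forced to have constant rows.
module Matching {n p q b A} (S : Situation n p q b A) where

  open Situation S
  open Dual dual
  open Aligned algb

  private
    Umir = to (tableau A (Diagonal.entry A)) (Diagonal.filling A)
    U = proj₁ Umir
    F = proj₁ (proj₂ Umir)
    rev = proj₂ (proj₂ Umir)

    Vmir = from (tableau b (Diagonal.entry b)) (Diagonal.filling b)

    <b : ∀ {i} → i < n → i < length b
    <b = subst (_ <_) (sym |b|)

    q+< : ∀ {i} → i < p → q + i < length b
    q+< i< = subst (_ <_) (trans q+p≡n (sym |b|)) (+-monoʳ-< q i<)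

    U-contents : ∀ i j → i + suc j ≡ n → countEntry (suc i) U ≡ A ! j
    U-contents i j e = trans (mirror rev i j e) (Diagonal.contents A j (subst (j <_) (sym |A|) (opposite-< i e)))

    V-contents : ∀ i j → i + suc j ≡ n → countEntry (suc i) (proj₁ Vmir) ≡ b ! j
    V-contents i j e = trans (mirror (proj₂ (proj₂ Vmir)) i j e) (Diagonal.contents b j (<b (opposite-< i e)))

    -- A value of column c+1 that misses column c would close a strict cycle. The contents of V are
    -- the parts of b, so the excess sum of b is at most that of A; the contents of U are the parts
    -- of A, so the excess sum of A would be strictly less than that of b.
    nested : ∀ {i c x} → i < length b → suc c < b ! i → U ‼ i ! suc c ≡ suc x →
             ∃ λ r → r < length U × U ‼ r ! c ≡ suc x
    nested {i} {c} {x} i< c< e with count (suc x) (column c U) in z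
    ... | suc _ = count-column-find c U (subst (0 <_) (sym z) z<s)
    ... | zero  = contradiction (begin-strict
      sumTo (λ k → b ! k ∸ suc c) n
        ≡⟨ sumTo-reverse n (λ k j h → cong (_∸ suc c) (sym (V-contents j k (opposite-swap k j h)))) ⟩
      sumTo (λ k → countEntry (suc k) (proj₁ Vmir) ∸ suc c) n
        ≡⟨ cong (sumTo _) (sym |A|) ⟩
      sumTo (λ k → countEntry (suc k) (proj₁ Vmir) ∸ suc c) (length A)
        ≤⟨ Excess.excess (proj₁ (proj₂ Vmir)) (suc c) ⟩
      sumTo (λ k → A ! k ∸ suc c) (length A)
        ≡⟨ cong (sumTo _) |A| ⟩
      sumTo (λ k → A ! k ∸ suc c) n
        ≡⟨ sumTo-reverse n (λ k j h → cong (_∸ suc c) (sym (U-contents j k (opposite-swap k j h)))) ⟩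
      sumTo (λ k → countEntry (suc k) U ∸ suc c) n
        ≡⟨ cong (sumTo _) (sym |b|) ⟩
      sumTo (λ k → countEntry (suc k) U ∸ suc c) (length b)
        <⟨ Excess.excess-< F i< c< e z ⟩
      sumTo (λ k → b ! k ∸ suc c) (length b)
        ≡⟨ cong (sumTo _) |b| ⟩
      sumTo (λ k → b ! k ∸ suc c) n ∎) (<-irrefl refl)
      where open ≤-Reasoning

    -- Values above p mirror to the q zero parts of A and so do not occur in U. This leaves 1,...,p
    -- for the p strictly increasing first entries.
    first-cell : ∀ i → i < p → U ‼ (q + i) ! 0 ≡ suc i
    first-cell = squeeze (λ i → U ‼ (q + i) ! 0) bnd
      λ i i< → cell-first F (+-monoʳ-< q (n<1+n i)) (q+< i<) (positive i (<⇒≤ i<)) (positive (suc i) i<)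
      where
      bnd : ∀ i → i < p → 1 ≤ U ‼ (q + i) ! 0 × U ‼ (q + i) ! 0 ≤ p
      bnd i i< with U ‼ (q + i) ! 0 in e | cell-≥1 F (q+< i<) (positive i i<) | cell-≤ F (q+< i<) (positive i i<)
      ... | suc x | h | s≤s x≤ with j , eq ← opposite (≤-<-trans x≤ (subst (q + i <_) |b| (q+< i<))) =
        h , ≰⇒> λ p≤x → <-irrefl refl (subst (0 <_)
              (trans (U-contents x j eq) (Aligned.zeros algA j (+-cancelˡ-≤ p _ _
                (≤-trans (+-monoˡ-≤ (suc j) p≤x) (≤-reflexive (trans eq (trans (sym q+p≡n) (+-comm q p))))))))
              (countEntry-cell U (subst (q + i <_) (sym (rows-length F)) (q+< i<))
                (subst (0 <_) (sym (row-length F (q + i))) (positive i i<)) e))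

    -- Induction on the column, and inside a column on the row, with m as the bound. An entry of row
    -- i in column c+1 already stands in column c, hence is the value `suc r′` of a row r′.
    -- Decreasing rows exclude i < r′. If r′ < i and row r′ is shorter than row i, the two rows form
    -- a forbidden type B triple; if it is not shorter, then by induction it has the same value in
    -- column c+1.
    cells : ∀ c i → i < p → c < b ! (q + i) → U ‼ (q + i) ! c ≡ suc i
    next-cells : ∀ c m i → i < m → i < p → suc c < b ! (q + i) → U ‼ (q + i) ! suc c ≡ suc i

    cells zero    i i< c< = first-cell i i<
    cells (suc c) i i< c< = next-cells c (suc i) i ≤-refl i< c<

    next-cells c (suc m) i i<m i< c< with U ‼ (q + i) ! suc c in e | cell-≥1 F (q+< i<) c<
    ... | suc x | _ with r , r< , e′ ← nested (q+< i<) c< e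
      with r′ , refl , r′< ← support-split (subst (r <_) (trans (rows-length F) (trans |b| (sym q+p≡n))) r<)
             (≤-<-trans z≤n (subst (c <_) (row-length F r) (!-positive (U ‼ r) c e′)))
      with refl ← suc-injective (trans (sym (cells c r′ r′< (subst (c <_) (row-length F r) (!-positive (U ‼ r) c e′)))) e′)
      with <-cmp r′ i
    ... | tri≈ _ refl _ = refl
    ... | tri> _ _ i<r′ = contradiction
      (≤-trans (≤-reflexive (sym e)) (≤-trans (cell-decreasing F (q+< i<) c<) (≤-reflexive (cells c i i< (<⇒≤ c<)))))
      (<⇒≱ (s<s i<r′))
    ... | tri< r′<i _ _ with b ! (q + r′) <? b ! (q + i)
    ... | yes lt = contradiction
      ( subst₂ _≤_ (sym e′) (sym (cells c i i< (<⇒≤ c<))) (s≤s (<⇒≤ r′<i)) , ≤-reflexive (trans e (sym e′)))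
      (cell-typeB F (+-monoʳ-< q r′<i) (q+< i<)
        (subst (c <_) (row-length F r) (!-positive (U ‼ r) c e′)) c< lt)
    ... | no ≮ = contradiction
      (trans (next-cells c m r′ (<-≤-trans r′<i (s≤s⁻¹ i<m)) r′< c<r′) (sym e))
      (cell-distinct F (+-monoʳ-< q r′<i) (q+< i<) c<r′ c<)
      where c<r′ = ≤-trans c< (≮⇒≥ ≮)

  -- Both sides count the value `suc i` in U: mirroring gives a part of A, and the constant row
  -- `q + i`, the only one holding this value, gives its length.
  parts : ∀ i j → i < p → i + suc j ≡ n → A ! j ≡ b ! (q + i)
  parts i j i< e = trans (sym (U-contents i j e)) (trans
    (countEntry-only F (q+< i<) λ r r< ne c c< e′ →
      let (r′ , eq , r′<) = support-split (subst (r <_) (trans |b| (sym q+p≡n)) r<) (≤-<-trans z≤n c<)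
      in ne (trans (sym eq) (cong (q +_) (suc-injective (trans
           (sym (cells c r′ r′< (subst (λ r → c < b ! r) (sym eq) c<))) (trans (cong (λ r → U ‼ r ! c) eq) e′))))))
    (row-constant F λ c c< → cells c i i< c<))

-- Restrictions on adjacent parts

count-last : ∀ {k} r {l} → length r ≡ suc l → (∀ c → c < l → r ! c ≢ k) → r ! l ≡ k → count k r ≡ 1
count-last (x ∷ [])    refl h e = count-∷-≡ [] e
count-last (x ∷ y ∷ r) refl h e = trans (count-∷-≢ (y ∷ r) (h 0 z<s))
  (count-last (y ∷ r) refl (λ c c< → h (suc c) (s<s c<)) e)

count-first-two : ∀ {k} r → 1 < length r → r ! 0 ≡ k → r ! 1 ≡ k → 2 ≤ count k r
count-first-two (_ ∷ [])    (s≤s ()) _ _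
count-first-two (x ∷ y ∷ r) _ e e′ = subst (2 ≤_)
  (sym (trans (count-∷-≡ (y ∷ r) e) (cong suc (count-∷-≡ r e′)))) (s≤s (s≤s z≤n))

predecessor : ∀ {m} → 0 < m → ∃ λ l → suc l ≡ m
predecessor {suc l} _ = l , refl

module Obstructions {n p q b A} (S : Situation n p q b A) where

  open Situation S
  open Dual dual

  private
    opposite-+ : ∀ {i j k l} → i + suc j ≡ n → k + suc l ≡ n → i < k → l < j
    opposite-+ {i} {j} {k} {l} e f i<k = s≤s⁻¹ (+-cancelˡ-< i _ _
      (<-≤-trans (+-monoˡ-< (suc l) i<k) (≤-reflexive (trans f (sym e)))))

    q+<n : ∀ {i} → i < p → q + i < n
    q+<n i< = subst (_ <_) q+p≡n (+-monoʳ-< q i<)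

  -- Otherwise replace the last entry of row i+1 in the lowest filling of b
  -- by the entry of row i: then b has a filling whose contents exceed
  -- those of A in the reversed order.
  no-jump : ∀ i → suc i < p → ¬ (2 + b ! (q + i) ≤ b ! (q + suc i))
  no-jump i si<p jump = <⇒≱ excess bounded-above
    where
    open Aligned algb
    j = q + suc i

    f : ℕ → ℕ
    f r = suc (r ∸ q)

    f+ : ∀ k → f (q + k) ≡ suc k
    f+ k = cong suc (m+n∸m≡n q k)

    mono : ∀ r s → r < s → s < length b → 0 < b ! r → 0 < b ! s → f r < f s
    mono r s r<s _ pr _ = s<s (∸-monoˡ-< r<s (support pr))

    avoid : ∀ r → r < length b → j < length b → r ≢ j → b ! j ≤ b ! r → suc i ≢ f r
    avoid r _ _ _ le e = contradiction jump (<⇒≱ (≤-trans (s≤s (≤-trans le (≤-reflexive (cong (b !_) r≡)))) (n≤1+n _)))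
      where
      q≤r : q ≤ r
      q≤r = support (≤-trans (≤-trans (s≤s z≤n) jump) le)
      r≡ : r ≡ q + i
      r≡ = trans (sym (m+[n∸m]≡n q≤r)) (cong (q +_) (sym (suc-injective e)))

    -- The jump by at least 2 enters here: row `q + i`, which carries the value `suc i`, is not
    -- exactly one cell shorter than row j, so it forms no type B triple with the changed cell.
    below : ∀ r → r < j → j < length b → suc (b ! r) ≡ b ! j → f r < suc i
    below r r<j _ e = s<s (≤∧≢⇒< r∸q≤i λ eq → <⇒≱ jump (≤-trans (≤-reflexive (sym e))
      (≤-reflexive (cong (suc ∘ (b !_)) (trans (sym (m+[n∸m]≡n q≤r)) (cong (q +_) eq))))))
      where
      q≤r : q ≤ r
      q≤r = support (s≤s⁻¹ (≤-trans (s≤s (s≤s z≤n)) (≤-trans jump (≤-reflexive (sym e)))))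
      r∸q≤i : r ∸ q ≤ i
      r∸q≤i = s≤s⁻¹ (subst (r ∸ q <_) (m+n∸m≡n q (suc i)) (∸-monoˡ-< r<j q≤r))

    module Q = Perturbed b f j (suc i)

    T = tableau b Q.entry

    G : Filling b T
    G = Q.filling mono (λ r _ _ → s≤s z≤n , s≤s (m∸n≤m r q))
      (λ _ → ≤-trans (s≤s (s≤s z≤n)) jump , s≤s z≤n , ≤-reflexive (sym (f+ (suc i))))
      avoid below

    Umir = from T G
    U = proj₁ Umir
    F = proj₁ (proj₂ Umir)
    rev = proj₂ (proj₂ Umir)

    <b : ∀ {r} → r < p → q + r < length b
    <b r< = subst (_ <_) (sym |b|) (q+<n r<)

    row≤ : ∀ k → k ≤ i → b ! (q + k) ≤ countEntry (suc k) T
    row≤ k k≤i = countEntry-row G (<b k<p) λ c c< →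
      trans (tableau-cell b Q.entry (<b k<p) c<)
        (trans (Q.entry-other c (<⇒≢ (+-monoʳ-< q (s≤s k≤i)))) (f+ k))
      where k<p = ≤-<-trans k≤i (<⇒≤ si<p)

    last-cell : ∀ l → suc l ≡ b ! j → 0 < count (suc i) (T ‼ j)
    last-cell l e = count-∈ (T ‼ j) {l}
      (subst (l <_) (sym (row-length G j)) (≤-reflexive e))
      (trans (tableau-cell b Q.entry (<b si<p) (≤-reflexive e)) (Q.entry-last e))

    two-rows : suc (b ! (q + i)) ≤ countEntry (suc i) T
    two-rows = let (l , e) = predecessor (≤-trans (s≤s z≤n) jump) in begin
      suc (b ! (q + i))
        ≡⟨ +-comm 1 _ ⟩
      b ! (q + i) + 1
        ≤⟨ +-mono-≤ (≤-reflexive (sym (row-constant G λ c c< →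
             trans (tableau-cell b Q.entry (<b (<⇒≤ si<p)) c<)
               (trans (Q.entry-other c (<⇒≢ (+-monoʳ-< q (n<1+n i)))) (f+ i))))) (last-cell l e) ⟩
      count (suc i) (T ‼ (q + i)) + count (suc i) (T ‼ j)
        ≤⟨ count+count≤countEntry T (+-monoʳ-< q (n<1+n i)) (subst (j <_) (sym (rows-length G)) (<b si<p)) ⟩
      countEntry (suc i) T ∎
      where open ≤-Reasoning

    topp = opposite (<-≤-trans (<⇒≤ si<p) (subst (p ≤_) q+p≡n (m≤n+m p q)))
    t = proj₁ topp
    t-eq = opposite-swap i t (proj₂ topp)

    excess : b ! (q + i) < countEntry (suc t) U
    excess = subst (b ! (q + i) <_) (sym (mirror rev t i t-eq)) two-rows

    -- Values above `suc t` mirror values below `suc i`, whose rows in T are unchanged, so each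
    -- occurs often enough to fill its own row of U. Hence `suc t` is confined to row t, whose
    -- length is `b ! (q + i)`.
    bounded-above : countEntry (suc t) U ≤ b ! (q + i)
    bounded-above = ≤-trans (≤-reflexive (top-count F n t (subst (t <_) (sym |A|) (opposite-< i (proj₂ topp)))
        (≤-trans (≤-reflexive |A|) (m≤n+m n t)) above))
      (≤-trans (count-row≤ F (suc t) t) (≤-reflexive (Matching.parts S i t (<⇒≤ si<p) (proj₂ topp))))
      where
      above : ∀ k → t < k → k < length A → A ! k ≤ countEntry (suc k) U
      above k t<k k< with l , e ← opposite (subst (k <_) |A| k<) =
        ≤-trans (≤-reflexive (Matching.parts S l k (≤-<-trans (<⇒≤ l<i) (<⇒≤ si<p)) (opposite-swap k l e)))
          (≤-trans (row≤ l (<⇒≤ l<i)) (≤-reflexive (sym (mirror rev k l e))))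
        where l<i = opposite-+ t-eq e t<k

  -- Otherwise leave out the value i in the lowest filling of A, and put it at the end
  -- of row i+1: no filling of b has the reversed contents.
  no-descent : ∀ i k → suc i < p → 1 ≤ q → 2 ≤ k → A ! (q + i) ≡ suc k → A ! (q + suc i) ≢ k
  no-descent i k si<p 1≤q 2≤k ek ek′ = two-≰-one
    where
    open Aligned algA
    j = q + suc i

    -- From row `q + i` on all values are raised by one, which frees the value `suc i`. The raised
    -- values respect the row bound because `1 ≤ q`.
    f : ℕ → ℕ
    f r with r <? q + i
    ... | yes _ = suc (r ∸ q)
    ... | no _  = suc (suc (r ∸ q))

    f-low : ∀ {r} → r < q + i → f r ≡ suc (r ∸ q)
    f-low {r} r< with r <? q + i
    ... | yes _ = refl
    ... | no ≮  = contradiction r< ≮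

    f-high : ∀ {r} → q + i ≤ r → f r ≡ suc (suc (r ∸ q))
    f-high {r} r≥ with r <? q + i
    ... | yes lt = contradiction r≥ (<⇒≱ lt)
    ... | no _   = refl

    f-bounds : ∀ r → suc (r ∸ q) ≤ f r × f r ≤ suc (suc (r ∸ q))
    f-bounds r with r <? q + i
    ... | yes _ = ≤-refl , n≤1+n _
    ... | no _  = n≤1+n _ , ≤-refl

    mono : ∀ r s → r < s → s < length A → 0 < A ! r → 0 < A ! s → f r < f s
    mono r s r<s _ pr _ with r <? q + i
    ... | yes _ = ≤-trans (s<s (∸-monoˡ-< r<s (support pr))) (proj₁ (f-bounds s))
    ... | no ≮  = subst (suc (suc (r ∸ q)) <_) (sym (f-high (≤-trans (≮⇒≥ ≮) (<⇒≤ r<s))))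
                    (s<s (s<s (∸-monoˡ-< r<s (support pr))))

    bound : ∀ r → r < length A → 0 < A ! r → 1 ≤ f r × f r ≤ suc r
    bound r _ pr = ≤-trans (s≤s z≤n) (proj₁ (f-bounds r))
      , ≤-trans (proj₂ (f-bounds r)) (s≤s (∸-monoʳ-< 1≤q (support pr)))

    change : j < length A → 2 ≤ A ! j × 1 ≤ suc i × suc i < f j
    change _ = subst (2 ≤_) (sym ek′) 2≤k , s≤s z≤n
      , subst (λ m → suc i < m) (sym (f-high (+-monoʳ-≤ q (n≤1+n i))))
          (s<s (≤-trans (n<1+n i) (≤-trans (≤-reflexive (sym (m+n∸m≡n q (suc i)))) (n≤1+n _))))

    i-missing : ∀ r → 0 < A ! r → f r ≢ suc i
    i-missing r pr e with r <? q + i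
    ... | yes lt = contradiction (suc-injective e) (<⇒≢ (subst (r ∸ q <_) (m+n∸m≡n q i) (∸-monoˡ-< lt (support pr))))
    ... | no ≮   = contradiction (suc-injective e)
                     (≢-sym (<⇒≢ (s≤s (subst (_≤ r ∸ q) (m+n∸m≡n q i) (∸-monoˡ-≤ q (≮⇒≥ ≮))))))

    -- Row `q + i` is one cell longer than row j, so it is no candidate; the remaining rows below j
    -- carry values less than `suc i`.
    below : ∀ r → r < j → j < length A → suc (A ! r) ≡ A ! j → f r < suc i
    below r r<j _ e with <-cmp r (q + i)
    ... | tri< lt _ _ = subst (_< suc i) (sym (f-low lt))
                          (s<s (subst (r ∸ q <_) (m+n∸m≡n q i) (∸-monoˡ-< lt (support pr))))
      where pr = s≤s⁻¹ (≤-trans (subst (2 ≤_) (sym ek′) 2≤k) (≤-reflexive (sym e)))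
    ... | tri≈ _ refl _ = contradiction (trans (cong suc (sym ek)) (trans e ek′)) λ eq →
                            <-irrefl refl (subst (k <_) eq (s≤s (n≤1+n k)))
    ... | tri> _ _ gt = contradiction r<j (≤⇒≯ (subst (_≤ r) (sym (+-suc q i)) gt))

    module Q = Perturbed A f j (suc i)

    T = tableau A Q.entry

    G : Filling A T
    G = Q.filling mono bound change
      (λ r _ _ _ le → i-missing r (≤-trans (≤-trans (s≤s z≤n) (subst (2 ≤_) (sym ek′) 2≤k)) le) ∘ sym) below

    Umir = to T G
    U = proj₁ Umir
    F = proj₁ (proj₂ Umir)
    rev = proj₂ (proj₂ Umir)

    <A : ∀ {r} → r < p → q + r < length A
    <A r< = subst (_ <_) (sym |A|) (q+<n r<)

    i<p : i < p
    i<p = <⇒≤ si<p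

    cell : ∀ r → r < p → r ≢ suc i → ∀ c → c < A ! (q + r) → T ‼ (q + r) ! c ≡ f (q + r)
    cell r r< ne c c< = trans (tableau-cell A Q.entry (<A r<) c<)
      (Q.entry-other c (ne ∘ +-cancelˡ-≡ q r (suc i)))

    low-rows : ∀ r → r < i → A ! (q + r) ≤ countEntry (suc r) T
    low-rows r r< = countEntry-row G (<A (<-trans r< i<p)) λ c c< →
      trans (cell r (<-trans r< i<p) (<⇒≢ (m<n⇒m<1+n r<)) c c<)
        (trans (f-low (+-monoʳ-< q r<)) (cong suc (m+n∸m≡n q r)))

    row-i : suc k ≤ countEntry (suc (suc i)) T
    row-i = ≤-trans (≤-reflexive (sym ek)) (countEntry-row G (<A i<p) λ c c< →
      trans (cell i i<p (<⇒≢ (n<1+n i)) c c<) (trans (f-high ≤-refl) (cong (suc ∘ suc) (m+n∸m≡n q i))))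

    value-i : countEntry (suc i) T ≡ 1
    value-i = trans
      (countEntry-only G (<A si<p) λ r r< ne c c< e →
        i-missing r (≤-<-trans z≤n c<) (trans (sym (Q.entry-other c ne)) (trans (sym (tableau-cell A Q.entry r< c<)) e)))
      (count-last (T ‼ j) (trans (row-length G j) (trans ek′ (sym l≡)))
        (λ c c<l e → i-missing j (≤-<-trans z≤n (c<A c<l)) (trans
          (sym (Q.entry-inner (subst (suc c <_) l≡A (s<s c<l))))
          (trans (sym (tableau-cell A Q.entry (<A si<p) (c<A c<l))) e)))
        (trans (tableau-cell A Q.entry (<A si<p) (≤-reflexive l≡A)) (Q.entry-last l≡A)))
      where
      k-1 = predecessor (≤-trans (s≤s z≤n) 2≤k)
      l = proj₁ k-1
      l≡ = proj₂ k-1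

      l≡A : suc l ≡ A ! j
      l≡A = trans l≡ (sym ek′)

      c<A : ∀ {c} → c < l → c < A ! j
      c<A c<l = subst (_ <_) l≡A (m<n⇒m<1+n c<l)

    p≤n : p ≤ n
    p≤n = subst (p ≤_) q+p≡n (m≤n+m p q)

    -- The mirror of the rare value `suc i` is `suc t`, and that of `suc (suc i)`, which fills row
    -- `q + i` of T, is `suc s`. In b the rows s and t = s+1 have lengths k and k+1.
    sopp = opposite (<-≤-trans si<p p≤n)
    s = proj₁ sopp
    t = suc s

    i+t : i + suc t ≡ n
    i+t = trans (+-suc i (suc s)) (proj₂ sopp)

    t<n : t < n
    t<n = opposite-< i i+t

    t<b : t < length b
    t<b = subst (t <_) (sym |b|) t<n

    s<b : s < length b
    s<b = <⇒≤ t<b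

    b-t : b ! t ≡ suc k
    b-t = trans (Matching.parts (Situation-swap S) i t i<p i+t) ek

    b-s : b ! s ≡ k
    b-s = trans (Matching.parts (Situation-swap S) (suc i) s si<p (proj₂ sopp)) ek′

    above : ∀ r → t < r → r < length b → b ! r ≤ countEntry (suc r) U
    above r t<r r< with l , e ← opposite (subst (r <_) |b| r<) =
      ≤-trans (≤-reflexive (Matching.parts (Situation-swap S) l r (<-trans l<i i<p) (opposite-swap r l e)))
        (≤-trans (low-rows l l<i) (≤-reflexive (sym (mirror rev r l e))))
      where l<i = opposite-+ (opposite-swap i t i+t) e t<r

    count-t : count (suc t) (U ‼ t) ≡ 1
    count-t = trans (sym (top-count F n t t<b (≤-trans (≤-reflexive |b|) (m≤n+m n t)) above))
      (trans (mirror rev t i (opposite-swap i t i+t)) value-i)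

    count-s : suc k ≤ countEntry (suc s) U
    count-s = ≤-trans row-i (≤-reflexive (sym (mirror rev s (suc i) (opposite-swap (suc i) s (proj₂ sopp)))))

    -- Rows below s have smaller entries and rows above t are filled with their own values. If row s
    -- also lacked `suc s`, all of its at least k+1 occurrences would lie in row t and fill it,
    -- leaving no cell for `suc t`.
    s-in-row-s : 0 < count (suc s) (U ‼ s)
    s-in-row-s with count (suc s) (U ‼ s) in z
    ... | suc _ = z<s
    ... | zero  = contradiction t∈ λ (c , c< , e) → <-irrefl
      (trans (sym (count-full (U ‼ t) (≤-trans (≤-reflexive (trans (row-length F t) b-t))
        (≤-trans count-s (≤-reflexive only-t))) c c<)) e)
      (n<1+n (suc s))
      where
      t∈ : ∃ λ c → c < length (U ‼ t) × U ‼ t ! c ≡ suc t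
      t∈ = count-find (U ‼ t) (subst (0 <_) (sym count-t) z<s)

      only-t : countEntry (suc s) U ≡ count (suc s) (U ‼ t)
      only-t = countEntry-only F t<b other
        where
        other : ∀ r → r < length b → r ≢ t → ∀ c → c < b ! r → U ‼ r ! c ≢ suc s
        other r r< ne c c< e with <-cmp r s
        ... | tri< r<s _ _  = <⇒≱ r<s (s≤s⁻¹ (≤-trans (≤-reflexive (sym e)) (cell-≤ F r< c<)))
        ... | tri≈ _ refl _ = contradiction (count-∈ (U ‼ s) (subst (c <_) (sym (row-length F s)) c<) e)
                                λ pos → <-irrefl (sym z) pos
        ... | tri> _ _ s<r  = <⇒≢ s<r (suc-injective (trans (sym e)
          (top-cells F n r r< (≤-trans (≤-reflexive |b|) (m≤n+m n r))
            (λ r′ r≤r′ → above r′ (<-≤-trans (≤∧≢⇒< s<r (≢-sym ne)) r≤r′)) c c<)))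

    0<b-s : 0 < b ! s
    0<b-s = subst (0 <_) (sym b-s) (≤-trans (s≤s z≤n) 2≤k)

    1<b-t : 1 < b ! t
    1<b-t = subst (1 <_) (sym b-t) (≤-trans 2≤k (n≤1+n k))

    s-first : U ‼ s ! 0 ≡ suc s
    s-first with c , c< , e ← count-find (U ‼ s) s-in-row-s = ≤-antisym (cell-≤ F s<b 0<b-s)
      (≤-trans (≤-reflexive (sym e)) (row-antitone F s<b z≤n (subst (c <_) (row-length F s) c<)))

    -- Row s begins with `suc s` and is shorter than row t. The type B triple on the first two cells
    -- of row t therefore forces the second one above `suc s`, hence to the maximum `suc t`; the
    -- first cell follows, and `suc t` occurs twice.
    t-second : U ‼ t ! 1 ≡ suc t
    t-second = ≤-antisym (cell-≤ F t<b 1<b-t) (subst (λ m → suc m ≤ U ‼ t ! 1) s-first (≰⇒> λ le →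
      cell-typeB F (n<1+n s) t<b 0<b-s 1<b-t (subst₂ _<_ (sym b-s) (sym b-t) (n<1+n k))
        (<⇒≤ (cell-first F (n<1+n s) t<b 0<b-s (<⇒≤ 1<b-t)) , le)))

    t-first : U ‼ t ! 0 ≡ suc t
    t-first = ≤-antisym (cell-≤ F t<b (<⇒≤ 1<b-t))
      (≤-trans (≤-reflexive (sym t-second)) (cell-decreasing F t<b 1<b-t))

    two-≰-one : ⊥
    two-≰-one = <-irrefl (sym count-t)
      (count-first-two (U ‼ t) (subst (1 <_) (sym (row-length F t)) 1<b-t) t-first t-second)

-- From adjacent parts to the three families

adjDiffLe1 : ∀ l → (∀ i → suc i < length l → l ! i ≤ suc (l ! suc i) × l ! suc i ≤ suc (l ! i)) → AdjDiffLe1 l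
adjDiffLe1 []          h = []
adjDiffLe1 (x ∷ [])    h = [ x ]
adjDiffLe1 (x ∷ y ∷ l) h = h 0 (s<s z<s) ∷ adjDiffLe1 (y ∷ l) λ i i< → h (suc i) (s<s i<)

-- What remains for two adjacent parts when zeros are present: they differ by at most 1, and pairs
-- {k, k+1} with k ≥ 2 are excluded.
Flat : ℕ → ℕ → Set
Flat u v = u ≡ v ⊎ (u ≤ 2 × v ≤ 2)

one-or-two : ∀ {x} → 0 < x → x ≤ 2 → x ≡ 1 ⊎ x ≡ 2
one-or-two {suc zero}          _ _ = inj₁ refl
one-or-two {suc (suc zero)}    _ _ = inj₂ refl
one-or-two {suc (suc (suc _))} _ (s≤s (s≤s ()))

flat-small : ∀ x l → x ≤ 2 → (∀ i → i < length (x ∷ l) → 0 < (x ∷ l) ! i) →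
             (∀ i → suc i < length (x ∷ l) → Flat ((x ∷ l) ! i) ((x ∷ l) ! suc i)) →
             All (λ x → x ≡ 1 ⊎ x ≡ 2) (x ∷ l)
flat-small x []      x≤2 pos h = one-or-two (pos 0 z<s) x≤2 ∷ []
flat-small x (y ∷ l) x≤2 pos h = one-or-two (pos 0 z<s) x≤2 ∷
  flat-small y l (y≤2 (h 0 (s<s z<s))) (λ i i< → pos (suc i) (s<s i<)) (λ i i< → h (suc i) (s<s i<))
  where
  y≤2 : Flat x y → y ≤ 2
  y≤2 (inj₁ refl)      = x≤2
  y≤2 (inj₂ (_ , y≤2)) = y≤2

flat-large : ∀ x l → 2 < x → (∀ i → suc i < length (x ∷ l) → Flat ((x ∷ l) ! i) ((x ∷ l) ! suc i)) →
             x ∷ l ≡ replicate (length (x ∷ l)) x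
flat-large x []      2<x h = refl
flat-large x (y ∷ l) 2<x h with h 0 (s<s z<s)
... | inj₁ refl      = cong (x ∷_) (flat-large x l 2<x λ i i< → h (suc i) (s<s i<))
... | inj₂ (x≤2 , _) = contradiction x≤2 (<⇒≱ 2<x)

-- The first part decides: a part above 2 is passed on unchanged to its neighbour, and a part of at
-- most 2 has a neighbour of at most 2.
flat : ∀ l → (∀ i → i < length l → 0 < l ! i) → (∀ i → suc i < length l → Flat (l ! i) (l ! suc i)) →
       (∃ λ k → l ≡ replicate (length l) k) ⊎ All (λ x → x ≡ 1 ⊎ x ≡ 2) l
flat []      pos h = inj₂ []
flat (x ∷ l) pos h with 2 <? x
... | yes lt = inj₁ (x , flat-large x l lt h)
... | no ≮   = inj₂ (flat-small x l (≮⇒≥ ≮) pos h)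

zeros≡replicate : ∀ l → (∀ i → i < length l → l ! i ≡ 0) → l ≡ replicate (length l) 0
zeros≡replicate []      h = refl
zeros≡replicate (x ∷ l) h = cong₂ _∷_ (h 0 z<s) (zeros≡replicate l λ i i< → h (suc i) (s<s i<))

take-! : ∀ p l {i} → i < p → take p l ! i ≡ l ! i
take-! (suc p) []      i<p = refl
take-! (suc p) (x ∷ l) {zero}  i<p = refl
take-! (suc p) (x ∷ l) {suc i} i<p = take-! p l (s<s⁻¹ i<p)

drop-! : ∀ p l i → drop p l ! i ≡ l ! (p + i)
drop-! zero    l       i = refl
drop-! (suc p) []      i = refl
drop-! (suc p) (x ∷ l) i = drop-! p l i

-- `Condition` for lists: at `toList a` the two unfold to the same type.
ListCondition : List ℕ → Set
ListCondition a =
  (Σ ℕ λ k → Σ ℕ λ p → Σ ℕ λ q → a ≡ replicate p k ++ replicate q 0) ⊎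
  (Σ (List ℕ) λ l → Σ ℕ λ q → All (λ x → x ≡ 1 ⊎ x ≡ 2) l × a ≡ l ++ replicate q 0) ⊎
  (All (0 <_) a × AdjDiffLe1 a)

module Necessity {n p q b} (a : List ℕ) (|a| : length a ≡ n) (S : Situation n p q b (reverse a)) where

  private
    A = reverse a
    S′ = Situation-swap S

    q+p≡n = Situation.q+p≡n S

    A! : ∀ i j → j + suc i ≡ n → A ! j ≡ a ! i
    A! i j e = !-reverse a j i (trans e (sym |a|))

    b! : ∀ i → i < p → b ! (q + i) ≡ a ! i
    b! i i< with j , e ← opposite (<-≤-trans i< (subst (p ≤_) q+p≡n (m≤n+m p q))) =
      trans (sym (Matching.parts S i j i< e)) (A! i j (opposite-swap i j e))

    A!+ : ∀ i j → i + suc j ≡ p → A ! (q + i) ≡ a ! j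
    A!+ i j e = A! j (q + i) (trans (+-assoc q i (suc j)) (trans (cong (q +_) e) q+p≡n))

    positive : ∀ i → i < p → 0 < a ! i
    positive i i< = subst (0 <_) (b! i i<) (Aligned.positive (Situation.algb S) i i<)

    zero-tail : ∀ i → i < q → a ! (p + i) ≡ 0
    zero-tail i i< with j , e ← opposite i< = trans
      (sym (A! (p + i) j (trans (cong (j +_) (sym (+-suc p i))) (trans (+-comm j _)
        (trans (+-assoc p (suc i) j) (trans (cong (p +_) (trans (+-comm (suc i) j) (opposite-swap i j e)))
          (trans (+-comm p q) q+p≡n)))))))
      (Aligned.zeros (Situation.algA S) j (opposite-< i e))

    steps : ∀ i → suc i < p → a ! i ≤ suc (a ! suc i) × a ! suc i ≤ suc (a ! i)
    steps i si< with j , e ← opposite si< = s≤s⁻¹ (≰⇒> down) , s≤s⁻¹ (≰⇒> up)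
      -- The positive parts appear in b in the order of `a` and in A in the opposite order. The same
      -- one-sided obstruction thus bounds ascents when applied to b and descents when applied to A.
      where
      up : ¬ (2 + a ! i ≤ a ! suc i)
      up h = Obstructions.no-jump S i si<
        (subst₂ (λ u v → 2 + u ≤ v) (sym (b! i (<⇒≤ si<))) (sym (b! (suc i) si<)) h)
      j+ : suc j + suc i ≡ p
      j+ = opposite-swap i (suc j) (trans (+-suc i (suc j)) e)
      down : ¬ (2 + a ! suc i ≤ a ! i)
      down h = Obstructions.no-jump S′ j (subst (suc j <_) j+ (m<m+n (suc j) z<s))
        (subst₂ (λ u v → 2 + u ≤ v) (sym (A!+ j (suc i) (trans (+-suc j (suc i)) j+))) (sym (A!+ (suc j) i j+)) h)

    flat-step : ∀ u v → u ≤ suc v × v ≤ suc u → (2 ≤ v → u ≢ suc v) → (2 ≤ u → v ≢ suc u) → Flat u v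
    flat-step u v (u≤ , v≤) hu hv with <-cmp u v
    ... | tri≈ _ e _  = inj₁ e
    ... | tri< lt _ _ = inj₂ (u≤2 , ≤-trans v≤ u<2)
      where
      u<2 = ≰⇒> λ 2≤u → hv 2≤u (≤-antisym v≤ lt)
      u≤2 = <⇒≤ u<2
    ... | tri> _ _ gt = inj₂ (≤-trans u≤ v<2 , <⇒≤ v<2)
      where
      v<2 = ≰⇒> λ 2≤v → hu 2≤v (≤-antisym u≤ gt)

    flat-steps : 0 < q → ∀ i → suc i < p → Flat (a ! i) (a ! suc i)
    flat-steps 0<q i si< with j , e ← opposite si< = flat-step _ _ (steps i si<)
      (λ 2≤ eq → Obstructions.no-descent S′ i (a ! suc i) si< 0<q 2≤ (trans (b! i (<⇒≤ si<)) eq) (b! (suc i) si<))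
      (λ 2≤ eq → Obstructions.no-descent S j (a ! i) (subst (suc j <_) (j+ e) (m<m+n (suc j) z<s)) 0<q 2≤
        (trans (A!+ j (suc i) (trans (+-suc j (suc i)) (j+ e))) eq) (A!+ (suc j) i (j+ e)))
      where
      j+ : ∀ {j} → suc i + suc j ≡ p → suc j + suc i ≡ p
      j+ {j} f = opposite-swap i (suc j) (trans (+-suc i (suc j)) f)

    l = take p a

    |l| : length l ≡ p
    |l| = trans (length-take p a) (m≤n⇒m⊓n≡m (subst (p ≤_) (trans q+p≡n (sym |a|)) (m≤n+m p q)))

    l! : ∀ {i} → i < length l → l ! i ≡ a ! i
    l! i< = take-! p a (subst (_ <_) |l| i<)

    a≡ : a ≡ l ++ replicate q 0
    a≡ = trans (sym (take++drop≡id p a)) (cong (l ++_) (trans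
      (zeros≡replicate (drop p a) λ i i< → trans (drop-! p a i) (zero-tail i (subst (i <_) |drop| i<)))
      (cong (λ m → replicate m 0) |drop|)))
      where |drop| = trans (length-drop p a) (trans (cong (_∸ p) (trans |a| (sym q+p≡n))) (m+n∸n≡m q p))

  no-tail : q ≡ 0 → ListCondition a
  no-tail q≡0 = inj₂ (inj₂ (subst (λ a → All (0 <_) a × AdjDiffLe1 a) (sym a≡l)
    ( All-! l (λ i i< → subst (0 <_) (sym (l! i<)) (positive i (subst (i <_) |l| i<)))
    , adjDiffLe1 l (λ i i< → subst₂ (λ u v → u ≤ suc v × v ≤ suc u) (sym (l! (<⇒≤ i<))) (sym (l! i<))
        (steps i (subst (suc i <_) |l| i<))))))
    where
    a≡l : a ≡ l
    a≡l = trans a≡ (trans (cong (λ m → l ++ replicate m 0) q≡0) (++-identityʳ l))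

  tail : 0 < q → ListCondition a
  tail 0<q = by (flat l (λ i i< → subst (0 <_) (sym (l! i<)) (positive i (subst (i <_) |l| i<)))
                        (λ i i< → subst₂ Flat (sym (l! (<⇒≤ i<))) (sym (l! i<))
                          (flat-steps 0<q i (subst (suc i <_) |l| i<))))
    where
    by : (∃ λ k → l ≡ replicate (length l) k) ⊎ All (λ x → x ≡ 1 ⊎ x ≡ 2) l → ListCondition a
    by (inj₁ (k , e)) = inj₁ (k , length l , q , trans a≡ (cong (_++ replicate q 0) e))
    by (inj₂ h)       = inj₂ (inj₁ (l , q , h , a≡))

  condition : ListCondition a
  condition with q ≟ 0
  ... | yes q≡0 = no-tail q≡0
  ... | no q≢0  = tail (n≢0⇒n>0 q≢0)

-- Compositions without zero parts

tableau-unique : ∀ {a T} E → Filling a T → (∀ {i c} → i < length a → c < a ! i → T ‼ i ! c ≡ E i c) → T ≡ tableau a E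
tableau-unique {a} {T} E F h = trans (sym (applyUpTo-‼ T)) (trans (cong (applyUpTo (T ‼_)) (rows-length F))
  (applyUpTo-cong (length a) λ i i< → trans (sym (applyUpTo-! (T ‼ i)))
    (trans (cong (applyUpTo (T ‼ i !_)) (row-length F i)) (applyUpTo-cong (a ! i) λ c c< → h i< c<))))

record Gentle (a : List ℕ) : Set where
  field
    positive : ∀ i → i < length a → 0 < a ! i
    ascent   : ∀ i → suc i < length a → a ! suc i ≤ suc (a ! i)
    descent  : ∀ i → suc i < length a → a ! i ≤ suc (a ! suc i)

Gentle-reverse : ∀ {a} → Gentle a → Gentle (reverse a)
Gentle-reverse {a} g = record
  { positive = λ i i< → let (j , e) = opposite (subst (i <_) |r| i<) in
      subst (0 <_) (sym (!-reverse a i j e)) (positive j (opposite-< i e))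
  ; ascent  = λ i i< → let (j , e , e′ , j<) = neighbours i i< in
      subst₂ (λ u v → u ≤ suc v) (sym (!-reverse a (suc i) j e)) (sym (!-reverse a i (suc j) e′)) (descent j j<)
  ; descent = λ i i< → let (j , e , e′ , j<) = neighbours i i< in
      subst₂ (λ u v → u ≤ suc v) (sym (!-reverse a i (suc j) e′)) (sym (!-reverse a (suc i) j e)) (ascent j j<)
  }
  where
  open Gentle g
  |r| = length-reverse a
  neighbours : ∀ i → suc i < length (reverse a) →
    ∃ λ j → (suc i + suc j ≡ length a) × (i + suc (suc j) ≡ length a) × suc j < length a
  neighbours i i< with j , e ← opposite (subst (suc i <_) |r| i<) =
    j , e , e′ , opposite-< i e′
    where e′ = trans (+-suc i (suc j)) e

-- A discrete intermediate value argument: the first part after position k that exceeds c follows a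
-- part of at most c and can exceed it by at most 1, so it equals c+1. It comes before `k + d`,
-- where the part is larger still.
first-above : ∀ (a : List ℕ) {m c} d k → (∀ i → suc i < m → a ! suc i ≤ suc (a ! i)) → k + d < m →
              a ! k ≤ c → suc c < a ! (k + d) → ∃ λ j → k < j × j < k + d × a ! j ≡ suc c
first-above a zero    k asc _ le lt =
  contradiction (≤-trans (≤-reflexive (cong (a !_) (+-identityʳ k))) le) (<⇒≱ (<-trans (n<1+n _) lt))
first-above a {m} {c} (suc d) k asc k+d< le lt rewrite +-suc k d with a ! suc k ≤? c
... | yes le′ = let (j , k<j , j< , e) = first-above a d (suc k) asc k+d< le′ lt in j , <⇒≤ k<j , j< , e
... | no ≰    = suc k , ≤-refl , s≤s (≤∧≢⇒< (m≤m+n k d) λ eq → <-irrefl (trans (sym e) (cong (λ m → a ! suc m) eq)) lt) , e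
  where e = ≤-antisym (≤-trans (asc k (≤-<-trans (s≤s (m≤m+n k d)) k+d<)) (s≤s le)) (≰⇒> ≰)

-- Where an entry k < i would first appear in row i, some row j between k and i would form
-- a type B triple with it, since lengths grow by at most 1 from row to row.
module Rigid {a T} (g : Gentle a) (F : Filling a T) where

  open Gentle g

  private
    n = length a

    first-cell : ∀ i → i < n → T ‼ i ! 0 ≡ suc i
    first-cell = squeeze (λ i → T ‼ i ! 0)
      (λ i i< → cell-≥1 F i< (positive i i<) , ≤-trans (cell-≤ F i< (positive i i<)) i<)
      (λ i i< → cell-first F (n<1+n i) i< (positive i (<⇒≤ i<)) (positive (suc i) i<))

    -- Row j has a cell in column c but is shorter than row i, and k ≤ j < i. Its entry `suc j`
    -- therefore lies between `suc k` and `suc i`, which is the forbidden type B pattern.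
    ledge : ∀ {i k c} → k < i → i < n → suc c < a ! i → a ! k < a ! i →
            ∃ λ j → k ≤ j × j < i × c < a ! j × a ! j < a ! i
    ledge {i} {k} {c} k<i i< c< lt with c <? a ! k
    ... | yes c<k = k , ≤-refl , k<i , c<k , lt
    ... | no ≮ =
      let k+ = m+[n∸m]≡n (<⇒≤ k<i)
          (j , k<j , j< , e) = first-above a (i ∸ k) k ascent (subst (_< n) (sym k+) i<)
                                 (≮⇒≥ ≮) (subst (λ i → suc c < a ! i) (sym k+) c<)
      in j , <⇒≤ k<j , subst (j <_) k+ j< , ≤-reflexive (sym e) , subst (_< a ! i) (sym e) c<

  cells : ∀ c i → i < n → c < a ! i → T ‼ i ! c ≡ suc i
  next-cells : ∀ c m i → i < m → i < n → suc c < a ! i → T ‼ i ! suc c ≡ suc i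

  cells zero    i i< c< = first-cell i i<
  cells (suc c) i i< c< = next-cells c (suc i) i ≤-refl i< c<

  next-cells c (suc m) i i<m i< c< with T ‼ i ! suc c in e | cell-≥1 F i< c<
  ... | suc k | _ with <-cmp k i
  ... | tri≈ _ refl _ = refl
  ... | tri> _ _ i<k = contradiction
    (≤-trans (≤-reflexive (sym e)) (≤-trans (cell-decreasing F i< c<) (≤-reflexive (cells c i i< (<⇒≤ c<)))))
    (<⇒≱ (s<s i<k))
  ... | tri< k<i _ _ with a ! k <? a ! i
  ... | no ≮ = contradiction (trans (next-cells c m k (<-≤-trans k<i (s≤s⁻¹ i<m)) (<-trans k<i i<) c<k) (sym e))
                 (cell-distinct F k<i i< c<k c<)
    where c<k = ≤-trans c< (≮⇒≥ ≮)
  ... | yes lt with j , k≤j , j<i , c<j , j<ᵃi ← ledge k<i i< c< lt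
               with ej ← cells c j (<-trans j<i i<) c<j = contradiction
    ( subst₂ _≤_ (sym ej) (sym (cells c i i< (<⇒≤ c<))) (s≤s (<⇒≤ j<i))
    , subst₂ _≤_ (sym e) (sym ej) (s≤s k≤j))
    (cell-typeB F j<i i< c<j c< j<ᵃi)

  diagonal : T ≡ tableau a (Diagonal.entry a)
  diagonal = tableau-unique (Diagonal.entry a) F λ {i} {c} i< c< → trans (cells c i i< c<)
    (sym (trans (sym (tableau-cell a (Diagonal.entry a) i< c<)) (Diagonal.cell a i< c<)))

-- Both polynomials are a single monomial, that of the filling by row numbers. Since all fillings of
-- `a` coincide, the trivial relation is already injective.
coeffQK-gentle-≤ : ∀ {a w} → Gentle a → length w ≡ length a → coeffQK a w ≤ coeffQK (reverse a) (reverse w)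
coeffQK-gentle-≤ {a} {w} g |w| = coeffQK-≤ {b = reverse a} {w} (λ _ _ → ⊤) |w|
  (λ T F → tableau (reverse a) (Diagonal.entry (reverse a)) , Diagonal.filling (reverse a) , reversed (rev T F) , tt)
  (λ F F′ _ _ → trans (Rigid.diagonal g F) (sym (Rigid.diagonal g F′)))
  where
  rev : ∀ T → Filling a T → ∀ i j → i + suc j ≡ length a →
        countEntry (suc i) (tableau (reverse a) (Diagonal.entry (reverse a))) ≡ countEntry (suc j) T
  rev T F i j e = trans
    (Diagonal.contents (reverse a) i (subst (i <_) (sym (length-reverse a)) (opposite-< j (opposite-swap i j e))))
    (trans (!-reverse a i j e)
      (sym (trans (cong (countEntry (suc j)) (Rigid.diagonal g F)) (Diagonal.contents a j (opposite-< i e)))))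

coeffQK-gentle : ∀ {a w} → Gentle a → length w ≡ length a → coeffQK a w ≡ coeffQK (reverse a) (reverse w)
coeffQK-gentle {a} {w} g |w| = ≤-antisym (coeffQK-gentle-≤ {w = w} g |w|)
  (subst₂ (λ a′ w′ → coeffQK (reverse a) (reverse w) ≤ coeffQK a′ w′) (reverse-involutive a) (reverse-involutive w)
    (coeffQK-gentle-≤ {reverse a} {reverse w} (Gentle-reverse g)
      (trans (length-reverse w) (trans |w| (sym (length-reverse a))))))

-- Rectangles: contents and order of columns

-- X can stand next to the column Z in a filling with rows of equal length.
infixr 5 _∷_
data Next : List ℕ → List ℕ → Set where
  []  : Next [] []
  _∷_ : ∀ {z x Z X} → x ≤ z × All (λ y → ¬ (y ≤ z × x ≤ y)) X → Next Z X → Next (z ∷ Z) (x ∷ X)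

-- The head of X is the largest entry of X that does not exceed the head of Z. If the heads of X and
-- Y differed, each would occur in the other list and each would have to be larger than the other.
Next-unique : ∀ {Z X Y} → Next Z X → Next Z Y → X ↭ Y → X ≡ Y
Next-unique [] [] p = refl
Next-unique ((x≤z , x-max) ∷ nx) ((y≤z , y-max) ∷ ny) p
  with ∈-resp-↭ p (here refl) | ∈-resp-↭ (↭-sym p) (here refl)
... | here refl | _         = cong (_ ∷_) (Next-unique nx ny (drop-∷ p))
... | there _   | here refl = cong (_ ∷_) (Next-unique nx ny (drop-∷ p))
... | there x∈  | there y∈  = contradiction
  (≰⇒> λ y≤x → All.lookup y-max x∈ (x≤z , y≤x))
  (<⇒≯ (≰⇒> λ x≤y → All.lookup x-max y∈ (y≤z , x≤y)))

-- The largest element of x ∷ X that is at most z can be exchanged for x.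
pick-max : ∀ {z x X Z} → Unique (x ∷ X) → x ≤ z → Pointwise _≤_ X Z →
  ∃ λ y → ∃ λ Y → y ∷ Y ↭ x ∷ X × y ≤ z × All (λ w → ¬ (w ≤ z × y ≤ w)) Y × Pointwise _≤_ Y Z
pick-max {x = x} _ x≤z [] = x , [] , ↭-refl , x≤z , [] , []
pick-max {z} {x} {v ∷ X} ((x≢v ∷ x∉) ∷ (v∉ ∷ u)) x≤z (v≤ ∷ X≤)
  with y , Y , perm , y≤z , max , Y≤ ← pick-max (x∉ ∷ u) x≤z X≤
  with v ≤? z | y ≤? v
... | no v≰z | _ = y , v ∷ Y , ↭-trans (↭-swap y v ↭-refl) (↭-trans (↭-prep v perm) (↭-swap v x ↭-refl)) , y≤z ,
                   (λ (v≤z , _) → v≰z v≤z) ∷ max , v≤ ∷ Y≤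
... | yes _ | no y≰v = y , v ∷ Y , ↭-trans (↭-swap y v ↭-refl) (↭-trans (↭-prep v perm) (↭-swap v x ↭-refl)) , y≤z ,
                   (λ (_ , y≤v) → y≰v y≤v) ∷ max , v≤ ∷ Y≤
... | yes v≤z | yes y≤v = v , y ∷ Y , ↭-trans (↭-prep v perm) (↭-swap v x ↭-refl) , v≤z ,
                   (λ (_ , v≤y) → v≢y (≤-antisym v≤y y≤v))
                     ∷ All.map (λ h (w≤z , v≤w) → h (w≤z , ≤-trans y≤v v≤w)) max ,
                   ≤-trans y≤v v≤ ∷ Y≤
  where
  v≢y : v ≢ y
  v≢y refl with ∈-resp-↭ perm (here refl)
  ... | here v≡x   = x≢v (sym v≡x)
  ... | there v∈X = All.lookup v∉ v∈X refl

Unique-resp : ∀ {X Y : List ℕ} → X ↭ Y → Unique X → Unique Y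
Unique-resp ↭.refl                 u                        = u
Unique-resp (↭.prep x p)           (x∉ ∷ u)                 = All-resp-↭ p x∉ ∷ Unique-resp p u
Unique-resp (↭.swap x y p)         ((x≢y ∷ x∉) ∷ (y∉ ∷ u)) =
  (≢-sym x≢y ∷ All-resp-↭ p y∉) ∷ (All-resp-↭ p x∉ ∷ Unique-resp p u)
Unique-resp (↭.trans p q)          u                        = Unique-resp q (Unique-resp p u)

-- The greedy choice, from the bottom up. It never gets stuck, since the exchange in `pick-max`
-- keeps the remaining entries pointwise below the remaining part of Z.
arrange : ∀ {Z X} → Unique X → Pointwise _≤_ X Z → ∃ λ Y → Y ↭ X × Next Z Y
arrange u [] = [] , ↭-refl , []
arrange u (x≤z ∷ X≤Z)
  with y , Y , perm , y≤z , max , Y≤Z ← pick-max u x≤z X≤Z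
  with _ ∷ u′ ← Unique-resp (↭-sym perm) u
  with Y′ , perm′ , next ← arrange u′ Y≤Z
  = y ∷ Y′ , ↭-trans (↭-prep y perm′) perm , (y≤z , All-resp-↭ (↭-sym perm′) max) ∷ next

Pointwise-↭ : ∀ {X Z Z′} → Pointwise _≤_ X Z → Z ↭ Z′ → ∃ λ X′ → X′ ↭ X × Pointwise _≤_ X′ Z′
Pointwise-↭ h ↭.refl = _ , ↭-refl , h
Pointwise-↭ (x≤ ∷ h) (↭.prep z p) = let (X′ , q , h′) = Pointwise-↭ h p in _ , ↭-prep _ q , x≤ ∷ h′
Pointwise-↭ (x≤ ∷ y≤ ∷ h) (↭.swap _ _ p) =
  let (X′ , q , h′) = Pointwise-↭ h p in _ , ↭-swap _ _ q , y≤ ∷ x≤ ∷ h′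
Pointwise-↭ h (↭.trans p q) =
  let (_ , r , h′) = Pointwise-↭ h p ; (X″ , s , h″) = Pointwise-↭ h′ q in X″ , ↭-trans s r , h″

-- S prescribes the contents of the columns. The order of each column depends on the order chosen
-- for the previous one, so the pointwise bound is first carried over to that order and then
-- `arrange` applies.
arrange-columns : ∀ k (S : ℕ → List ℕ) {D₀} → D₀ ↭ S 0 → (∀ c → c ≤ k → Unique (S c)) →
  (∀ c → c < k → Pointwise _≤_ (S (suc c)) (S c)) →
  ∃ λ (D : ℕ → List ℕ) → D 0 ≡ D₀ × (∀ c → c ≤ k → D c ↭ S c) × (∀ c → c < k → Next (D c) (D (suc c)))
arrange-columns zero S {D₀} p u h = (λ _ → D₀) , refl , (λ { zero z≤n → p }) , λ _ ()
arrange-columns (suc k) S {D₀} p u h =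
  let (X , q , X≤)   = Pointwise-↭ (h 0 z<s) (↭-sym p)
      (D₁ , r , next) = arrange (Unique-resp (↭-sym q) (u 1 (s≤s z≤n))) X≤
      (D , D0 , perm , nexts) = arrange-columns k (S ∘ suc) (↭-trans r q)
        (λ c c≤ → u (suc c) (s≤s c≤)) (λ c c< → h (suc c) (s<s c<))
  in (λ { zero → D₀ ; (suc c) → D c })
   , refl
   , (λ { zero _ → p ; (suc c) c≤ → perm c (s≤s⁻¹ c≤) })
   , (λ { zero _ → subst (Next D₀) (sym D0) next ; (suc c) c< → nexts c (s<s⁻¹ c<) })

sorted-unique : ∀ {X Y} → AllPairs _<_ X → AllPairs _<_ Y → X ↭ Y → X ≡ Y
sorted-unique {[]}    {Y}     sx sy p = sym (↭-empty-inv (↭-sym p))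
sorted-unique {x ∷ X} {[]}    sx sy p = contradiction (↭-length p) λ ()
sorted-unique {x ∷ X} {y ∷ Y} (x< ∷ sx) (y< ∷ sy) p
  with ∈-resp-↭ p (here refl) | ∈-resp-↭ (↭-sym p) (here refl)
... | here refl | _         = cong (x ∷_) (sorted-unique sx sy (drop-∷ p))
... | there _   | here refl = cong (x ∷_) (sorted-unique sx sy (drop-∷ p))
... | there x∈  | there y∈  = contradiction (All.lookup x< y∈) (<⇒≯ (All.lookup y< x∈))

sort-< : ∀ X → Unique X → AllPairs _<_ (sort X)
sort-< X u = AllPairs.zipWith (λ (x≤y , x≢y) → ≤∧≢⇒< x≤y x≢y)
  (Linked⇒AllPairs ≤-trans (sort-↗ X) , Unique-resp (↭-sym (sort-↭ X)) u)

InRange : ℕ → ℕ → Set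
InRange n x = 1 ≤ x × x ≤ n

comp : ℕ → ℕ → ℕ
comp n x = suc n ∸ x

comp-range : ∀ {n x} → InRange n x → InRange n (comp n x)
comp-range {n} {suc x} (_ , x<n) = m<n⇒0<n∸m x<n , m∸n≤m n x

comp-involutive : ∀ {n x} → InRange n x → comp n (comp n x) ≡ x
comp-involutive (_ , x≤n) = m∸[m∸n]≡n (m≤n⇒m≤1+n x≤n)

comp-suc : ∀ {n} i {j} → i + suc j ≡ n → comp n (suc j) ≡ suc i
comp-suc i {j} refl = trans (cong (_∸ j) (+-suc i j)) (m+n∸n≡m (suc i) j)

map-comp-range : ∀ {n X} → All (InRange n) X → All (InRange n) (map (comp n) X)
map-comp-range = All.map⁺ ∘ All.map comp-range

map-comp-involutive : ∀ {n X} → All (InRange n) X → map (comp n) (map (comp n) X) ≡ X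
map-comp-involutive []       = refl
map-comp-involutive (h ∷ hs) = cong₂ _∷_ (comp-involutive h) (map-comp-involutive hs)

map-comp-unique : ∀ {n X} → All (InRange n) X → Unique X → Unique (map (comp n) X)
map-comp-unique []       []       = []
map-comp-unique {n} {x ∷ X} (h ∷ hs) (x∉ ∷ u) = All.map⁺ (All.zipWith
  (λ (x≢y , h′) e → x≢y (trans (sym (comp-involutive h)) (trans (cong (comp n) e) (comp-involutive h′)))) (x∉ , hs))
  ∷ map-comp-unique hs u

-- Complementing reverses the inequality between neighbouring columns, so the complemented columns
-- read from right to left satisfy the bound that `arrange-columns` asks for.
map-comp-antitone : ∀ n {Z X} → Next Z X → Pointwise _≤_ (map (comp n) Z) (map (comp n) X)
map-comp-antitone n []               = []
map-comp-antitone n ((x≤z , _) ∷ nx) = ∸-monoʳ-≤ (suc n) x≤z ∷ map-comp-antitone n nx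

count-comp : ∀ {n} i j {X} → i + suc j ≡ n → All (InRange n) X → count (suc i) (map (comp n) X) ≡ count (suc j) X
count-comp i j e [] = refl
count-comp {n} i j {x ∷ X} e (h ∷ hs) with x ≟ suc j
... | yes refl = trans (count-∷-≡ {suc i} {comp n x} (map (comp n) X) (comp-suc i e))
                   (trans (cong suc (count-comp i j e hs)) (sym (count-∷-≡ {suc j} X refl)))
... | no x≢    = trans (count-∷-≢ {suc i} {comp n x} (map (comp n) X) λ eq → x≢ (trans (sym (comp-involutive h))
                     (trans (cong (comp n) eq) (comp-suc j (opposite-swap i j e)))))
                   (trans (count-comp i j e hs) (sym (count-∷-≢ X x≢)))

count-↭ : ∀ {k X Y} → X ↭ Y → count k X ≡ count k Y
count-↭ {k} p = ↭-length (filter-↭ _ p)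

-- `Valid` with the row bound replaced by the uniform bound n, so that the notion passes to blocks
-- of consecutive rows wherever they stand.
record Good (n : ℕ) (T : List (List ℕ)) : Set where
  field
    pairs : AllPairs Compatible T
    decr  : All Decreasing T
    range : All (All (InRange n)) T
open Good public

-- An injection, presented as a relation, that reverses the sequence of row lengths and complements
-- the contents. All pieces use the same n, which allows flips to be glued.
record Flip (n : ℕ) (l : List ℕ) : Set₁ where
  field
    R     : (T U : List (List ℕ)) → Set
    total : ∀ T → Good n T → map length T ≡ l →
            ∃ λ U → Good n U × map length U ≡ reverse l × Reversed n T U × R T U
    inj   : ∀ {T T′ U} → Good n T → Good n T′ → map length T ≡ l → map length T′ ≡ l → R T U → R T′ U → T ≡ T′

AllPairs-All : ∀ {A : Set} {P : A → Set} {R S : A → A → Set} → (∀ {x y} → P x → P y → R x y → S x y) →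
               ∀ {xs} → All P xs → AllPairs R xs → AllPairs S xs
AllPairs-All f []       []       = []
AllPairs-All f (p ∷ ps) (r ∷ rs) = All.zipWith (λ (q , s) → f p q s) (ps , r) ∷ AllPairs-All f ps rs

All-∀ : ∀ {A I : Set} {P : I → A → Set} {xs} → (∀ i → All (P i) xs) → All (λ x → ∀ i → P i x) xs
All-∀ {xs = []}     h = []
All-∀ {xs = x ∷ xs} h = (λ i → All.head (h i)) ∷ All-∀ (All.tail ∘ h)

AllPairs-∀ : ∀ {A I : Set} {R : I → A → A → Set} {xs} →
             (∀ i → AllPairs (R i) xs) → AllPairs (λ x y → ∀ i → R i x y) xs
AllPairs-∀ {xs = []}     h = []
AllPairs-∀ {xs = x ∷ xs} h = All-∀ (AllPairs.head ∘ h) ∷ AllPairs-∀ (AllPairs.tail ∘ h)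

HasLength : ℕ → List ℕ → Set
HasLength K r = length r ≡ K

rectangle : ∀ {m K} T → map length T ≡ replicate m K → length T ≡ m × All (HasLength K) T
rectangle {zero}  []      e = refl , []
rectangle {suc m} (r ∷ T) e = let (l , h) = rectangle T (∷-injectiveʳ e) in cong suc l , ∷-injectiveˡ e ∷ h

next-columns : ∀ {K c T} → suc c < K → All (HasLength K) T → AllPairs Compatible T → All Decreasing T →
               Next (column c T) (column (suc c) T)
next-columns c< [] [] [] = []
next-columns {c = c} c< (refl ∷ hs) (r ∷ rs) (d ∷ ds) =
  ( d c c<
  , All.map⁺ (All.zipWith (λ (h , compat) → typeA compat c c< (subst (suc c <_) (sym h) c<) (≤-reflexive h)) (hs , r)))
  ∷ next-columns c< hs rs ds

next-rows : ∀ c U → Next (column c U) (column (suc c) U) →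
            All (λ r → r ! suc c ≤ r ! c) U × AllPairs (λ r s → ¬ (s ! suc c ≤ r ! c × r ! suc c ≤ s ! suc c)) U
next-rows c []      []               = [] , []
next-rows c (r ∷ U) ((d , max) ∷ nx) = let (ds , ps) = next-rows c U nx in d ∷ ds , All.map⁻ max ∷ ps

row-≡ : ∀ {K r s} → length r ≡ K → length s ≡ K → (∀ c → c < K → r ! c ≡ s ! c) → r ≡ s
row-≡ {K} {r} {s} refl e h = trans (sym (applyUpTo-! r)) (trans (applyUpTo-cong K h)
  (trans (cong (applyUpTo (s !_)) (sym e)) (applyUpTo-! s)))

columns-≡ : ∀ {K} T T′ → length T ≡ length T′ → All (HasLength K) T → All (HasLength K) T′ →
            (∀ c → c < K → column c T ≡ column c T′) → T ≡ T′
columns-≡ []      []        _ _        _          _ = refl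
columns-≡ (r ∷ T) (r′ ∷ T′) e (h ∷ hs) (h′ ∷ hs′) eq = cong₂ _∷_
  (row-≡ h h′ λ c c< → ∷-injectiveˡ (eq c c<))
  (columns-≡ T T′ (suc-injective e) hs hs′ λ c c< → ∷-injectiveʳ (eq c c<))

countEntry-columns : ∀ k K T → All (HasLength K) T →
                     countEntry (suc k) T ≡ sumTo (λ c → count (suc k) (column c T)) K
countEntry-columns k K T h = trans (cong (countEntry (suc k)) (sym (map-take h))) (go K)
  where
  map-take : ∀ {T} → All (HasLength K) T → map (take K) T ≡ T
  map-take []                = refl
  map-take {r ∷ _} (h ∷ hs) = cong₂ _∷_ (take-all K r (≤-reflexive h)) (map-take hs)

  go : ∀ c → countEntry (suc k) (map (take c) T) ≡ sumTo (λ c → count (suc k) (column c T)) c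
  go zero    = countEntry-∉ (map (take 0) T) λ i i< c c< → contradiction
    (subst (λ r → c < length r) (map-‼ (take 0) T (subst (i <_) (length-map _ T) i<)) c<) λ ()
  go (suc c) = trans (countEntry-take-suc k c T) (trans (+-comm (count (suc k) (column c T)) _)
    (trans (cong (_+ count (suc k) (column c T)) (go c)) (sym (sumTo-last _ c))))

column-range : ∀ {n K c T} → c < K → All (HasLength K) T → All (All (InRange n)) T → All (InRange n) (column c T)
column-range {n} {K} {c} c< hs rs = All.map⁺ (All.zipWith (λ { {r} (h , q) → cell r (subst (c <_) (sym h) c<) q }) (hs , rs))
  where
  cell : ∀ r {c} → c < length r → All (InRange n) r → InRange n (r ! c)
  cell (x ∷ r) {zero}  _  (q ∷ _)  = q
  cell (x ∷ r) {suc c} c< (_ ∷ qs) = cell r (s<s⁻¹ c<) qs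

column-unique : ∀ {K c T} → c < K → All (HasLength K) T → AllPairs Compatible T → Unique (column c T)
column-unique {c = c} c< hs ps = AllPairs.map⁺ (AllPairs-All
  (λ h h′ compat → distinct compat c (subst (c <_) (sym h) c<) (subst (c <_) (sym h′) c<)) hs ps)

column-sorted : ∀ {k T} → All (HasLength (suc k)) T → AllPairs Compatible T → AllPairs _<_ (column 0 T)
column-sorted hs ps = AllPairs.map⁺ (AllPairs-All
  (λ h h′ compat → first-increasing compat (subst (0 <_) (sym h) z<s) (subst (0 <_) (sym h′) z<s)) hs ps)

reverse-replicate : ∀ m (x : ℕ) → reverse (replicate m x) ≡ replicate m x
reverse-replicate zero    x = refl
reverse-replicate (suc m) x = trans (unfold-reverse x (replicate m x))
  (trans (cong (_++ x ∷ []) (reverse-replicate m x)) (snoc m))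
  where
  snoc : ∀ m → replicate m x ++ x ∷ [] ≡ x ∷ replicate m x
  snoc zero    = refl
  snoc (suc m) = cong (x ∷_) (snoc m)

module _ (n m k : ℕ) where

  private
    K = suc k

    -- Columns are matched in reverse order and only up to permutation; their inner order is no
    -- extra data.
    _~_ : (T U : List (List ℕ)) → Set
    T ~ U = ∀ c → c ≤ k → column c U ↭ map (comp n) (column (k ∸ c) T)

    module Total (T : List (List ℕ)) (g : Good n T) (sh : map length T ≡ replicate m K) where

      hs = proj₂ (rectangle T sh)

      S : ℕ → List ℕ
      S c = map (comp n) (column (k ∸ c) T)

      k∸<K : ∀ c → k ∸ c < K
      k∸<K c = s≤s (m∸n≤m k c)

      S-range : ∀ c → All (InRange n) (S c)
      S-range c = map-comp-range (column-range (k∸<K c) hs (range g))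

      S-unique : ∀ c → Unique (S c)
      S-unique c = map-comp-unique (column-range (k∸<K c) hs (range g)) (column-unique (k∸<K c) hs (pairs g))

      S-fits : ∀ c → c < k → Pointwise _≤_ (S (suc c)) (S c)
      S-fits c c< = subst (λ d → Pointwise _≤_ (S (suc c)) (map (comp n) (column d T))) (sym k∸c)
        (map-comp-antitone n (next-columns (subst (_< K) k∸c (k∸<K c)) hs (pairs g) (decr g)))
        where
        k∸c : k ∸ c ≡ suc (k ∸ suc c)
        k∸c = +-∸-assoc 1 c<

      -- Sorting the first column provides its increase; the order of the others follows from it.
      arranged = arrange-columns k S (sort-↭ (S 0)) (λ c _ → S-unique c) S-fits

      D : ℕ → List ℕ
      D = proj₁ arranged

      D0 = proj₁ (proj₂ arranged)
      D-perm = proj₁ (proj₂ (proj₂ arranged))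
      D-next = proj₂ (proj₂ (proj₂ arranged))

      |D| : ∀ c → c ≤ k → length (D c) ≡ m
      |D| c c≤ = trans (↭-length (D-perm c c≤)) (trans (length-map (comp n) (column (k ∸ c) T))
        (trans (length-map (_! (k ∸ c)) T) (proj₁ (rectangle T sh))))

      U : List (List ℕ)
      U = applyUpTo (λ i → applyUpTo (λ c → D c ! i) K) m

      U-shape : map length U ≡ replicate m K
      U-shape = trans (map-applyUpTo _ length m) (trans
        (applyUpTo-cong m λ i _ → length-applyUpTo (λ c → D c ! i) K) (const m))
        where
        const : ∀ m → applyUpTo (λ _ → K) m ≡ replicate m K
        const zero    = refl
        const (suc m) = cong (K ∷_) (const m)

      us = proj₂ (rectangle U U-shape)

      U-column : ∀ c → c ≤ k → column c U ≡ D c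
      U-column c c≤ = trans (map-applyUpTo _ (_! c) m) (trans
        (applyUpTo-cong m λ i _ → !-applyUpTo (λ c → D c ! i) (s≤s c≤))
        (trans (cong (applyUpTo (D c !_)) (sym (|D| c c≤))) (applyUpTo-! (D c))))

      U~ : T ~ U
      U~ c c≤ = ↭-trans (↭-reflexive (U-column c c≤)) (D-perm c c≤)

      U-next : ∀ c → c < k → Next (column c U) (column (suc c) U)
      U-next c c< = subst₂ Next (sym (U-column c (<⇒≤ c<))) (sym (U-column (suc c) c<)) (D-next c c<)

      U-first : AllPairs (λ r s → r ! 0 < s ! 0) U
      U-first = AllPairs.map⁻ (subst (AllPairs _<_) (sym (trans (U-column 0 z≤n) D0)) (sort-< (S 0) (S-unique 0)))

      U-distinct : AllPairs (λ r s → ∀ ((c , _) : ∃ (_≤ k)) → r ! c ≢ s ! c) U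
      U-distinct = AllPairs-∀ λ (c , c≤) → AllPairs.map⁻ (Unique-resp (↭-sym (U~ c c≤)) (S-unique c))

      U-typeA : AllPairs (λ r s → ∀ ((c , _) : ∃ (_< k)) → ¬ (s ! suc c ≤ r ! c × r ! suc c ≤ s ! suc c)) U
      U-typeA = AllPairs-∀ λ (c , c<) → proj₂ (next-rows c U (U-next c c<))

      U-good : Good n U
      U-good = record
        { pairs = AllPairs-All (λ h h′ ((f , d) , t) → record
            { first-increasing = λ _ _ → f
            ; distinct = λ c c< _ → d (c , s≤s⁻¹ (subst (c <_) h c<))
            ; typeA = λ c c< _ _ → t (c , s<s⁻¹ (subst (suc c <_) h c<))
            ; typeB = λ c _ _ lt → contradiction lt (<-irrefl (trans h (sym h′)))
            }) us (AllPairs.zip (AllPairs.zip (U-first , U-distinct) , U-typeA))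
        ; decr = All.zipWith (λ (h , d) c c< → d (c , s<s⁻¹ (subst (suc c <_) h c<)))
            (us , All-∀ {I = ∃ (_< k)} λ (c , c<) → proj₁ (next-rows c U (U-next c c<)))
        ; range = All.zipWith (λ { {r} (h , q) → All-! r λ c c< → q (c , s≤s⁻¹ (subst (c <_) h c<)) })
            (us , All-∀ {I = ∃ (_≤ k)} λ (c , c≤) →
              All.map⁻ (All-resp-↭ (↭-sym (U~ c c≤)) (S-range c)))
        }

      U-reversed : ∀ i j → i + suc j ≡ n → countEntry (suc i) U ≡ countEntry (suc j) T
      U-reversed i j e = trans (countEntry-columns i K U us) (trans
        (sumTo-reverse K λ c d e′ → trans (count-↭ (U~ c (c≤k c d e′)))
          (trans (count-comp i j e (column-range (k∸<K c) hs (range g)))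
            (cong (λ d → count (suc j) (column d T)) (k∸c c d e′))))
        (sym (countEntry-columns j K T hs)))
        where
        c≤k : ∀ c d → c + suc d ≡ K → c ≤ k
        c≤k c d e = s≤s⁻¹ (opposite-< d (opposite-swap c d e))
        k∸c : ∀ c d → c + suc d ≡ K → k ∸ c ≡ d
        k∸c c d e = trans (cong (_∸ c) (suc-injective (trans (sym e) (+-suc c d)))) (m+n∸m≡n c d)

    -- Complementing twice shows that corresponding columns of T and T′ have the same contents. The
    -- first columns agree because both are sorted, and `Next-unique` passes equality on to the
    -- right.
    ~-injective : ∀ {T T′ U} → Good n T → Good n T′ → map length T ≡ replicate m K → map length T′ ≡ replicate m K →
                  T ~ U → T′ ~ U → T ≡ T′
    ~-injective {T} {T′} g g′ sh sh′ r r′ =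
      columns-≡ T T′ (trans (proj₁ (rectangle T sh)) (sym (proj₁ (rectangle T′ sh′)))) hs hs′ λ c c< → columns c (s≤s⁻¹ c<)
      where
      hs = proj₂ (rectangle T sh)
      hs′ = proj₂ (rectangle T′ sh′)

      perm : ∀ c → c ≤ k → column c T ↭ column c T′
      perm c c≤ = subst₂ _↭_ (map-comp-involutive (column-range (s≤s c≤) hs (range g)))
        (map-comp-involutive (column-range (s≤s c≤) hs′ (range g′)))
        (map⁺ (comp n) (subst (λ d → map (comp n) (column d T) ↭ map (comp n) (column d T′)) (m∸[m∸n]≡n c≤)
          (↭-trans (↭-sym (r (k ∸ c) (m∸n≤m k c))) (r′ (k ∸ c) (m∸n≤m k c)))))

      columns : ∀ c → c ≤ k → column c T ≡ column c T′
      columns zero    c≤ = sorted-unique (column-sorted hs (pairs g)) (column-sorted hs′ (pairs g′)) (perm 0 c≤)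
      columns (suc c) c≤ = Next-unique (next-columns (s<s c≤) hs (pairs g) (decr g))
        (subst (λ Z → Next Z (column (suc c) T′)) (sym (columns c (<⇒≤ c≤))) (next-columns (s<s c≤) hs′ (pairs g′) (decr g′)))
        (perm (suc c) c≤)

  flip-rectangle : Flip n (replicate m K)
  flip-rectangle = record
    { R     = _~_
    ; total = λ T g sh → let open Total T g sh in
        U , U-good , trans U-shape (sym (reverse-replicate m K)) , reversed U-reversed , U~
    ; inj   = ~-injective
    }

-- Sequences of ones and twos

Entries : (ℕ → Set) → List (List ℕ) → Set
Entries P = All (All P)

count-All : ∀ {P : ℕ → Set} {k r} → All P r → 0 < count k r → P k
count-All {P} {k} {x ∷ r} (p ∷ ps) pos with x ≟ k
... | yes refl = p
... | no ne    = count-All ps (subst (0 <_) (count-∷-≢ r ne) pos)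

Entries⁻ : ∀ {P k T} → Entries P T → 0 < countEntry k T → P k
Entries⁻ {P} {k} {r ∷ T} (h ∷ hs) pos with count k r in e
... | suc _ = count-All h (subst (0 <_) (sym e) z<s)
... | zero  = Entries⁻ hs pos

All-count : ∀ {P : ℕ → Set} r → (∀ k → 0 < count k r → P k) → All P r
All-count []      h = []
All-count (x ∷ r) h = h x (subst (0 <_) (sym (count-∷-≡ {x} r refl)) z<s)
  ∷ All-count r λ k pos → h k (≤-trans pos (count-≤-∷ k))
  where
  count-≤-∷ : ∀ k → count k r ≤ count k (x ∷ r)
  count-≤-∷ k = ≤-trans (m≤n+m _ (count k (x ∷ []))) (≤-reflexive (sym (count-∷ k x r)))

Entries⁺ : ∀ {P} T → (∀ k → 0 < countEntry k T → P k) → Entries P T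
Entries⁺ []      h = []
Entries⁺ (r ∷ T) h = All-count r (λ k pos → h k (≤-trans pos (m≤m+n _ _)))
  ∷ Entries⁺ T λ k pos → h k (≤-trans pos (m≤n+m _ (count k r)))

countEntry-++ : ∀ k T U → countEntry k (T ++ U) ≡ countEntry k T + countEntry k U
countEntry-++ k []      U = refl
countEntry-++ k (r ∷ T) U = trans (cong (count k r +_) (countEntry-++ k T U)) (sym (+-assoc (count k r) _ _))

-- When all entries of the lower row are smaller than those of the higher row, both kinds of triples
-- are inversion triples whatever the row lengths. Blocks with separated values can thus be stacked
-- freely.
compatible-separated : ∀ {v r s} → All (_< v) r → All (v ≤_) s → Compatible r s
compatible-separated {v} {r} {s} lo hi = record
  { first-increasing = λ p q → <-≤-trans (cell lo p) (cell hi q)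
  ; distinct = λ c p q → <⇒≢ (<-≤-trans (cell lo p) (cell hi q))
  ; typeA = λ c p q _ (le , _) → <⇒≱ (<-≤-trans (cell lo (<⇒≤ p)) (cell hi q)) le
  ; typeB = λ c p q _ (_ , le) → <⇒≱ (<-≤-trans (cell lo p) (cell hi q)) le
  }
  where
  cell : ∀ {P : ℕ → Set} {r c} → All P r → c < length r → P (r ! c)
  cell {r = x ∷ r} {zero}  (p ∷ ps) _  = p
  cell {r = x ∷ r} {suc c} (p ∷ ps) c< = cell ps (s<s⁻¹ c<)

OneOrTwo : ℕ → Set
OneOrTwo x = x ≡ 1 ⊎ x ≡ 2

++-injective : ∀ {A : Set} (xs ys : List A) {us vs} → length xs ≡ length ys → xs ++ us ≡ ys ++ vs → xs ≡ ys × us ≡ vs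
++-injective []       []       _ e = refl , e
++-injective (x ∷ xs) (y ∷ ys) l e =
  let (p , q) = ++-injective xs ys (suc-injective l) (∷-injectiveʳ e) in cong₂ _∷_ (∷-injectiveˡ e) p , q

map-≡-++ : ∀ {A B : Set} (f : A → B) T {xs ys} → map f T ≡ xs ++ ys →
           ∃ λ T₁ → ∃ λ T₂ → T ≡ T₁ ++ T₂ × map f T₁ ≡ xs × map f T₂ ≡ ys
map-≡-++ f T       {[]}     e = [] , T , refl , refl , e
map-≡-++ f (t ∷ T) {x ∷ xs} e =
  let (T₁ , T₂ , p , q , r) = map-≡-++ f T (∷-injectiveʳ e)
  in t ∷ T₁ , T₂ , cong (t ∷_) p , cong₂ _∷_ (∷-injectiveˡ e) q , r

AllPairs-++⁻ : ∀ {A : Set} {R : A → A → Set} xs {ys} → AllPairs R (xs ++ ys) →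
               AllPairs R xs × All (λ x → All (R x) ys) xs × AllPairs R ys
AllPairs-++⁻ []       ps       = [] , [] , ps
AllPairs-++⁻ (x ∷ xs) (p ∷ ps) =
  let (q , r , s) = AllPairs-++⁻ xs ps in All.++⁻ˡ xs p ∷ q , All.++⁻ʳ xs p ∷ r , s

good-++⁻ : ∀ {n} T {U} → Good n (T ++ U) → Good n T × Good n U
good-++⁻ T g = let (p , _ , q) = AllPairs-++⁻ T (pairs g) in
    record { pairs = p ; decr = All.++⁻ˡ T (decr g) ; range = All.++⁻ˡ T (range g) }
  , record { pairs = q ; decr = All.++⁻ʳ T (decr g) ; range = All.++⁻ʳ T (range g) }

good-++⁺ : ∀ {n v T U} → Good n T → Good n U → Entries (_< v) T → Entries (v ≤_) U → Good n (T ++ U)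
good-++⁺ {T = T} {U} g h lo hi = record
  { pairs = AllPairs.++⁺ (pairs g) (pairs h) (All.map (λ r< → All.map (λ s≥ → compatible-separated r< s≥) hi) lo)
  ; decr  = All.++⁺ (decr g) (decr h)
  ; range = All.++⁺ (range g) (range h)
  }

good-[_] : ∀ {n v} → InRange n v → Good n ((v ∷ []) ∷ [])
good-[ v-range ] = record { pairs = [] ∷ [] ; decr = (λ { c (s≤s ()) }) ∷ [] ; range = (v-range ∷ []) ∷ [] }

below-singleton : ∀ {v r} → OneOrTwo (length r) → Compatible r (v ∷ []) → Decreasing r → All (_< v) r
below-singleton {r = x ∷ []}     _ compat d = first-increasing compat z<s z<s ∷ []
below-singleton {r = x ∷ y ∷ []} _ compat d = x<v ∷ ≤-<-trans (d 0 (s<s z<s)) x<v ∷ []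
  where x<v = first-increasing compat z<s z<s
below-singleton {r = []}            (inj₁ ())
below-singleton {r = []}            (inj₂ ())
below-singleton {r = _ ∷ _ ∷ _ ∷ _} (inj₁ ())
below-singleton {r = _ ∷ _ ∷ _ ∷ _} (inj₂ ())

-- The first entry exceeds v by the increase of the first column. A second entry would, if at most
-- v, form a forbidden type B triple with the shorter row v; a third cell would not be reached by
-- this argument.
above-singleton : ∀ {v r} → OneOrTwo (length r) → Compatible (v ∷ []) r → All (v <_) r
above-singleton {r = x ∷ []}     _ compat = first-increasing compat z<s z<s ∷ []
above-singleton {r = x ∷ y ∷ []} _ compat = v<x
  ∷ ≰⇒> (λ y≤v → typeB compat 0 z<s (s<s z<s) (s<s z<s) (<⇒≤ v<x , y≤v)) ∷ []
  where v<x = first-increasing compat z<s z<s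
above-singleton {r = []}            (inj₁ ())
above-singleton {r = []}            (inj₂ ())
above-singleton {r = _ ∷ _ ∷ _ ∷ _} (inj₁ ())
above-singleton {r = _ ∷ _ ∷ _ ∷ _} (inj₂ ())

singleton-separates : ∀ {n v} T₁ {T₂} → Good n (T₁ ++ (v ∷ []) ∷ T₂) →
  All (OneOrTwo ∘ length) T₁ → All (OneOrTwo ∘ length) T₂ → Entries (_< v) T₁ × Entries (v <_) T₂
singleton-separates T₁ g h₁ h₂ with _ , q , (r ∷ _) ← AllPairs-++⁻ T₁ (pairs g) =
    All.zipWith (λ ((h , d) , c) → below-singleton h (All.head c) d) (All.zip (h₁ , All.++⁻ˡ T₁ (decr g)) , q)
  , All.zipWith (λ (h , c) → above-singleton h c) (h₂ , r)

comp-mono : ∀ {n v x} → x ≤ n → v < x → comp n x < comp n v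
comp-mono x≤n v<x = ∸-monoʳ-< v<x (m≤n⇒m≤1+n x≤n)

-- A property shared by all entries can be read off the contents, so it passes to the mirror image
-- although nothing is known about the position of its entries.
entries-reversed : ∀ {n T U} {P Q : ℕ → Set} → Good n T → Good n U → Reversed n T U →
                   (∀ {x} → InRange n x → P x → Q (comp n x)) → Entries P T → Entries Q U
entries-reversed {n} {T} {U} {P} {Q} g h rev f ps = Entries⁺ U λ k pos →
  at-entry k pos (Entries⁻ (range h) pos)
  where
  at-entry : ∀ k → 0 < countEntry k U → InRange n k → Q k
  at-entry (suc i) pos (_ , i<) with j , e ← opposite i< =
    let pos′ = subst (0 <_) (mirror rev i j e) pos
    in subst Q (comp-suc i e) (f (Entries⁻ (range g) pos′) (Entries⁻ ps pos′))

reverse-middle : ∀ {A : Set} (xs : List A) x ys → reverse (xs ++ x ∷ ys) ≡ reverse ys ++ x ∷ reverse xs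
reverse-middle xs x ys = trans (reverse-++ xs (x ∷ ys))
  (trans (cong (_++ reverse xs) (unfold-reverse x ys)) (++-assoc (reverse ys) (x ∷ []) (reverse xs)))

module _ {n l₁ l₂} (flip₁ : Flip n l₁) (flip₂ : Flip n l₂) (h₁ : All OneOrTwo l₁) (h₂ : All OneOrTwo l₂) where

  private
    module F₁ = Flip flip₁
    module F₂ = Flip flip₂

  -- The blocks change places, as their values are complemented. Recording the length of `U₂` makes
  -- the decomposition of U unique, which injectivity relies on.
  record Glued (T U : List (List ℕ)) : Set where
    field
      {T₁ T₂ U₁ U₂} : List (List ℕ)
      {v}     : ℕ
      v-range : InRange n v
      T≡      : T ≡ T₁ ++ (v ∷ []) ∷ T₂
      U≡      : U ≡ U₂ ++ (comp n v ∷ []) ∷ U₁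
      shape₁  : map length T₁ ≡ l₁
      shape₂  : map length T₂ ≡ l₂
      |U₂|    : length U₂ ≡ length l₂
      rel₁    : F₁.R T₁ U₁
      rel₂    : F₂.R T₂ U₂

  private
    lengths : ∀ {T : List (List ℕ)} {l} → map length T ≡ l → All OneOrTwo l → All (OneOrTwo ∘ length) T
    lengths refl h = All.map⁻ h

    glued-total : ∀ T → Good n T → map length T ≡ l₁ ++ 1 ∷ l₂ →
      ∃ λ U → Good n U × map length U ≡ reverse (l₁ ++ 1 ∷ l₂) × Reversed n T U × Glued T U
    glued-total T g sh with map-≡-++ length T sh
    ... | T₁ , (v ∷ []) ∷ T₂ , refl , sh₁ , sh₂ =
      let (g₁ , g′) = good-++⁻ T₁ g
          (gv , g₂) = good-++⁻ ((v ∷ []) ∷ []) g′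
          sh₂′ = ∷-injectiveʳ sh₂
          v-range = All.head (All.head (range gv))
          (below , above) = singleton-separates T₁ g (lengths sh₁ h₁) (lengths sh₂′ h₂)
          (U₁ , k₁ , ush₁ , rev₁ , r₁) = F₁.total T₁ g₁ sh₁
          (U₂ , k₂ , ush₂ , rev₂ , r₂) = F₂.total T₂ g₂ sh₂′
          v′ = comp n v
          U₂< : Entries (_< v′) U₂
          U₂< = entries-reversed g₂ k₂ rev₂ (λ x-range v<x → comp-mono (proj₂ x-range) v<x) above
          U₁> : Entries (v′ <_) U₁
          U₁> = entries-reversed g₁ k₁ rev₁ (λ _ x<v → comp-mono (proj₂ v-range) x<v) below
      in U₂ ++ (v′ ∷ []) ∷ U₁
       -- Two cuts: `suc v′` separates the single cell from the block above it, and `v′` separates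
       -- the lower block from both.
       , good-++⁺ k₂ (good-++⁺ {v = suc v′} good-[ comp-range v-range ] k₁ ((≤-refl ∷ []) ∷ []) U₁>)
           U₂< ((≤-refl ∷ []) ∷ All.map (All.map <⇒≤) U₁>)
       , trans (map-++ length U₂ _) (trans (cong₂ (λ x y → x ++ 1 ∷ y) ush₂ ush₁) (sym (reverse-middle l₁ 1 l₂)))
       , reversed (contents T₁ T₂ U₁ U₂ v-range rev₁ rev₂)
       , record { v-range = v-range ; T≡ = refl ; U≡ = refl ; shape₁ = sh₁ ; shape₂ = sh₂′
                ; |U₂| = trans (sym (length-map length U₂)) (trans (cong length ush₂) (length-reverse l₂))
                ; rel₁ = r₁ ; rel₂ = r₂ }
      where
      contents : ∀ T₁ T₂ U₁ U₂ {v} → InRange n v → Reversed n T₁ U₁ → Reversed n T₂ U₂ → ∀ i j → i + suc j ≡ n →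
        countEntry (suc i) (U₂ ++ (comp n v ∷ []) ∷ U₁) ≡ countEntry (suc j) (T₁ ++ (v ∷ []) ∷ T₂)
      contents T₁ T₂ U₁ U₂ {v} v-range rev₁ rev₂ i j e = begin
        countEntry (suc i) (U₂ ++ (comp n v ∷ []) ∷ U₁)
          ≡⟨ countEntry-++ (suc i) U₂ _ ⟩
        countEntry (suc i) U₂ + (count (suc i) (comp n v ∷ []) + countEntry (suc i) U₁)
          ≡⟨ cong₂ _+_ (mirror rev₂ i j e) (cong₂ _+_ (count-comp i j e (v-range ∷ [])) (mirror rev₁ i j e)) ⟩
        countEntry (suc j) T₂ + (count (suc j) (v ∷ []) + countEntry (suc j) T₁)
          ≡⟨ +-comm (countEntry (suc j) T₂) _ ⟩
        (count (suc j) (v ∷ []) + countEntry (suc j) T₁) + countEntry (suc j) T₂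
          ≡⟨ cong (_+ countEntry (suc j) T₂) (+-comm (count (suc j) (v ∷ [])) _) ⟩
        (countEntry (suc j) T₁ + count (suc j) (v ∷ [])) + countEntry (suc j) T₂
          ≡⟨ +-assoc (countEntry (suc j) T₁) _ _ ⟩
        countEntry (suc j) T₁ + countEntry (suc j) ((v ∷ []) ∷ T₂)
          ≡⟨ countEntry-++ (suc j) T₁ _ ⟨
        countEntry (suc j) (T₁ ++ (v ∷ []) ∷ T₂) ∎
        where open ≡-Reasoning
    ... | T₁ , []              , _ , _ , ()
    ... | T₁ , [] ∷ _          , _ , _ , ()
    ... | T₁ , (_ ∷ _ ∷ _) ∷ _ , _ , _ , ()

    glued-injective : ∀ {T T′ U} → Good n T → Good n T′ → map length T ≡ l₁ ++ 1 ∷ l₂ → map length T′ ≡ l₁ ++ 1 ∷ l₂ →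
                      Glued T U → Glued T′ U → T ≡ T′
    glued-injective g g′ _ _
      record { T₁ = T₁ ; U₂ = U₂ ; v = v ; v-range = v-range ; T≡ = refl ; U≡ = refl
             ; shape₁ = sh₁ ; shape₂ = sh₂ ; |U₂| = |U₂| ; rel₁ = r₁ ; rel₂ = r₂ }
      record { T₁ = T₁′ ; U₂ = U₂′ ; v = v′ ; v-range = v-range′ ; T≡ = refl ; U≡ = U≡
             ; shape₁ = sh₁′ ; shape₂ = sh₂′ ; |U₂| = |U₂′| ; rel₁ = r₁′ ; rel₂ = r₂′ }
      with refl , U₁≡ ← ++-injective U₂ U₂′ (trans |U₂| (sym |U₂′|)) U≡
      with refl ← ∷-injectiveʳ U₁≡
      with refl ← trans (sym (comp-involutive v-range))
                    (trans (cong (comp n) (∷-injectiveˡ (∷-injectiveˡ U₁≡))) (comp-involutive v-range′))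
      = cong₂ (λ T₁ T₂ → T₁ ++ (v ∷ []) ∷ T₂)
          (F₁.inj (proj₁ (good-++⁻ T₁ g)) (proj₁ (good-++⁻ T₁′ g′)) sh₁ sh₁′ r₁ r₁′)
          (F₂.inj (tail-good T₁ g) (tail-good T₁′ g′) sh₂ sh₂′ r₂ r₂′)
      where
      tail-good : ∀ T₁ {T₂} → Good n (T₁ ++ (v ∷ []) ∷ T₂) → Good n T₂
      tail-good T₁ g = proj₂ (good-++⁻ ((v ∷ []) ∷ []) (proj₂ (good-++⁻ T₁ g)))

  flip-glue : Flip n (l₁ ++ 1 ∷ l₂)
  flip-glue = record { R = Glued ; total = glued-total ; inj = glued-injective }

All-reverse : ∀ {P : ℕ → Set} {l} → All P l → All P (reverse l)
All-reverse {l = l} = All-resp-↭ (↭-sym (↭-reverse l))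

replicate-All : ∀ {P : ℕ → Set} m {x} → P x → All P (replicate m x)
replicate-All zero    p = []
replicate-All (suc m) p = p ∷ replicate-All m p

-- m counts the 2's seen so far, up to the next 1.
flip-ones-twos : ∀ n m l → All OneOrTwo l → Flip n (replicate m 2 ++ l)
flip-ones-twos n m []      []             = subst (Flip n) (sym (++-identityʳ (replicate m 2))) (flip-rectangle n m 1)
flip-ones-twos n m (1 ∷ l) (inj₁ refl ∷ h) =
  flip-glue (flip-rectangle n m 1) (flip-ones-twos n 0 l h) (replicate-All m (inj₂ refl)) h
flip-ones-twos n m (2 ∷ l) (inj₂ refl ∷ h) = subst (Flip n) (shift-2 m) (flip-ones-twos n (suc m) l h)
  where
  shift-2 : ∀ m → replicate (suc m) 2 ++ l ≡ replicate m 2 ++ 2 ∷ l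
  shift-2 zero    = refl
  shift-2 (suc m) = cong (2 ∷_) (shift-2 m)

-- Leading zero parts

empty-rows : ℕ → List (List ℕ)
empty-rows q = replicate q []

countEntry-empty : ∀ k q T → countEntry k (empty-rows q ++ T) ≡ countEntry k T
countEntry-empty k zero    T = refl
countEntry-empty k (suc q) T = countEntry-empty k q T

All-‼⁻ : ∀ {P : List ℕ → Set} {T} → All P T → ∀ i → i < length T → P (T ‼ i)
All-‼⁻ (p ∷ ps) zero    _  = p
All-‼⁻ (p ∷ ps) (suc i) i< = All-‼⁻ ps i (s<s⁻¹ i<)

AllPairs-‼⁻ : ∀ {R : List ℕ → List ℕ → Set} {T} → AllPairs R T → ∀ i j → i < j → j < length T → R (T ‼ i) (T ‼ j)
AllPairs-‼⁻ (p ∷ ps) zero    (suc j) _   j< = All-‼⁻ p j (s<s⁻¹ j<)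
AllPairs-‼⁻ (p ∷ ps) (suc i) (suc j) i<j j< = AllPairs-‼⁻ ps i j (s<s⁻¹ i<j) (s<s⁻¹ j<)

AllPairs-‼ : ∀ {R : List ℕ → List ℕ → Set} T → (∀ i j → i < j → j < length T → R (T ‼ i) (T ‼ j)) → AllPairs R T
AllPairs-‼ []      h = []
AllPairs-‼ (r ∷ T) h = All-‼ T (λ j j< → h 0 (suc j) z<s (s<s j<))
  ∷ AllPairs-‼ T λ i j i<j j< → h (suc i) (suc j) (s<s i<j) (s<s j<)

strip-zeros : ∀ q {l} T → map length T ≡ replicate q 0 ++ l → ∃ λ T′ → T ≡ empty-rows q ++ T′ × map length T′ ≡ l
strip-zeros zero    T       e = T , refl , e
strip-zeros (suc q) ([] ∷ T) e = let (T′ , p , e′) = strip-zeros q T (∷-injectiveʳ e) in T′ , cong ([] ∷_) p , e′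

filling-good : ∀ {n a T} → length a ≡ n → Filling a T → Good n T
filling-good {T = T} refl F = record
  { pairs = AllPairs-‼ T (compatible (valid F))
  ; decr  = All-‼ T (decreasing (valid F))
  ; range = All-‼ T λ i i< → All-! (T ‼ i) λ c c< → let (p , q) = bounded (valid F) i i< c c< in
      p , ≤-trans q (subst (i <_) (rows-length F) i<)
  }

compatible-[] : ∀ r → Compatible [] r
compatible-[] r = record { first-increasing = λ () ; distinct = λ _ () ; typeA = λ _ () ; typeB = λ _ () }

empty-pairs : ∀ q {T} → AllPairs Compatible T → AllPairs Compatible (empty-rows q ++ T)
empty-pairs zero    ps = ps
empty-pairs (suc q) ps = All.tabulate (λ {r} _ → compatible-[] r) ∷ empty-pairs q ps

empty-within : ∀ q s {T} → (∀ i → i < length T → Within (suc (s + q + i)) (T ‼ i)) →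
               ∀ i → i < length (empty-rows q ++ T) → Within (suc (s + i)) ((empty-rows q ++ T) ‼ i)
empty-within zero    s {T} h i       i< = subst (λ m → Within (suc (m + i)) (T ‼ i)) (+-identityʳ s) (h i i<)
empty-within (suc q) s h zero    i< = λ _ ()
empty-within (suc q) s {T} h (suc i) i< = subst (λ m → Within (suc m) ((empty-rows q ++ T) ‼ i)) (sym (+-suc s i))
  (empty-within q (suc s) (λ i i< → subst (λ m → Within (suc (m + i)) (T ‼ i)) (+-suc s q) (h i i<)) i (s<s⁻¹ i<))

-- The row bound is recovered: all rows above the q empty ones are nonempty, their first entries
-- increase strictly and end at most at n, so the entry in row i of T is at most q + i + 1, and the
-- row decreases from there.
good-filling : ∀ {n q l T} → q + length l ≡ n → All (0 <_) l → map length T ≡ l → Good n T →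
               Filling (replicate q 0 ++ l) (empty-rows q ++ T)
good-filling {n} {q} {l} {T} q+l≡n pos sh g = record
  { shape = trans (map-++ length (empty-rows q) T) (cong₂ _++_ (map-replicate length q []) sh)
  ; valid = record
    { decreasing = All-‼⁻ (All.++⁺ (All.tabulate {xs = empty-rows q} λ r∈ → empty-decreasing q r∈) (decr g))
    ; bounded    = empty-within q 0 bnd
    ; compatible = AllPairs-‼⁻ (empty-pairs q (pairs g))
    } }
  where
  empty-decreasing : ∀ q {r} → r ∈ empty-rows q → Decreasing r
  empty-decreasing (suc q) (here refl) c ()
  empty-decreasing (suc q) (there r∈)     = empty-decreasing q r∈

  |T| : length T ≡ length l
  |T| = trans (sym (length-map length T)) (cong length sh)

  row-pos : ∀ i → i < length T → 0 < length (T ‼ i)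
  row-pos = All-‼⁻ (All.map⁻ (subst (All (0 <_)) (sym sh) pos))

  cell-range : ∀ i → i < length T → Within n (T ‼ i)
  cell-range i i< c c< = go (T ‼ i) c c< (All-‼⁻ (range g) i i<)
    where
    go : ∀ r c → c < length r → All (InRange n) r → InRange n (r ! c)
    go (x ∷ r) zero    _  (h ∷ _) = h
    go (x ∷ r) (suc c) c< (_ ∷ h) = go r c (s<s⁻¹ c<) h

  first≤ : ∀ i → i < length T → T ‼ i ! 0 ≤ suc (q + i)
  first≤ = increasing-≤ q (λ i → T ‼ i ! 0)
    (λ i i< → ≤-trans (proj₂ (cell-range i i< 0 (row-pos i i<)))
      (≤-reflexive (trans (sym q+l≡n) (cong (q +_) (sym |T|)))))
    (λ i i< → first-increasing (AllPairs-‼⁻ (pairs g) i (suc i) ≤-refl i<) (row-pos i (<⇒≤ i<)) (row-pos (suc i) i<))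

  cell≤first : ∀ i → i < length T → ∀ c → c < length (T ‼ i) → T ‼ i ! c ≤ T ‼ i ! 0
  cell≤first i i< zero    c< = ≤-refl
  cell≤first i i< (suc c) c< = ≤-trans (All-‼⁻ (decr g) i i< c c<) (cell≤first i i< c (<⇒≤ c<))

  bnd : ∀ i → i < length T → Within (suc (q + i)) (T ‼ i)
  bnd i i< c c< = proj₁ (cell-range i i< c c<) , ≤-trans (cell≤first i i< c c<) (first≤ i i<)

module _ {n q l} (q+l≡n : q + length l ≡ n) (pos : All (0 <_) l) (flip : Flip n l) where

  private
    module F = Flip flip
    a = replicate q 0 ++ l

    |a| : length a ≡ n
    |a| = trans (length-++ (replicate q 0)) (trans (cong (_+ length l) (length-replicate q)) q+l≡n)

    Rel : (T U : List (List ℕ)) → Set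
    Rel T U = ∃ λ T′ → ∃ λ U′ → T ≡ empty-rows q ++ T′ × U ≡ empty-rows q ++ U′ × map length T′ ≡ l × F.R T′ U′

    reverse-pos : All (0 <_) (reverse l)
    reverse-pos = All-reverse pos

    total : ∀ T → Filling a T → ∃ λ U → Filling (replicate q 0 ++ reverse l) U × Reversed n T U × Rel T U
    total T fill with T′ , refl , sh ← strip-zeros q T (shape fill) =
      let (U , g , sh′ , rev , r) = F.total T′ (proj₂ (good-++⁻ (empty-rows q) (filling-good |a| fill))) sh
      in empty-rows q ++ U
       , good-filling (trans (cong (q +_) (length-reverse l)) q+l≡n) reverse-pos sh′ g
       , reversed (λ i j e → trans (countEntry-empty (suc i) q U)
           (trans (mirror rev i j e) (sym (countEntry-empty (suc j) q T′))))
       , T′ , U , refl , refl , sh , r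

    injective : ∀ {T T′ U} → Filling a T → Filling a T′ → Rel T U → Rel T′ U → T ≡ T′
    injective fill fill′ (T , U , refl , refl , sh , r) (T′ , U′ , refl , U≡ , sh′ , r′)
      with refl ← ++-cancelˡ (empty-rows q) U U′ U≡ = cong (empty-rows q ++_)
        (F.inj (proj₂ (good-++⁻ (empty-rows q) (filling-good |a| fill)))
               (proj₂ (good-++⁻ (empty-rows q) (filling-good |a| fill′))) sh sh′ r r′)

  coeffQK-flip-≤ : ∀ w → length w ≡ n → coeffQK a w ≤ coeffQK (replicate q 0 ++ reverse l) (reverse w)
  coeffQK-flip-≤ w |w| = coeffQK-≤ {w = w} Rel |w| total injective

coeffQK-flip : ∀ {n q l} w → q + length l ≡ n → All (0 <_) l → Flip n l → Flip n (reverse l) → length w ≡ n →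
               coeffQK (replicate q 0 ++ l) w ≡ coeffQK (replicate q 0 ++ reverse l) (reverse w)
coeffQK-flip {n} {q} {l} w q+l≡n pos f f′ |w| = ≤-antisym (coeffQK-flip-≤ q+l≡n pos f w |w|)
  (subst₂ (λ l′ w′ → coeffQK (replicate q 0 ++ reverse l) (reverse w) ≤ coeffQK (replicate q 0 ++ l′) w′)
    (reverse-involutive l) (reverse-involutive w)
    (coeffQK-flip-≤ (trans (cong (q +_) (length-reverse l)) q+l≡n)
      (All-reverse pos) f′ (reverse w) (trans (length-reverse w) |w|)))

-- The witness b keeps the order of `l` and moves the zeros to the front. The reverse of `a` has its
-- zeros in front too, so only `l` has to be flipped.
coeffQK-flat : ∀ {n} (a : Vec ℕ n) l q → toList a ≡ l ++ replicate q 0 → All (0 <_) l →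
  (∀ n → Flip n l) → (∀ n → Flip n (reverse l)) → ∃ λ (b : Vec ℕ n) → youngQuasiKey a ≈P quasiKey b
coeffQK-flat {n} a l q a≡ pos f f′ = b , λ w → begin
  coeffQK (reverse (toList a)) (reverse (toList w))
    ≡⟨ cong (λ c → coeffQK c (reverse (toList w))) (trans (cong reverse a≡)
         (trans (reverse-++ l (replicate q 0)) (cong (_++ reverse l) (reverse-replicate q 0)))) ⟩
  coeffQK (replicate q 0 ++ reverse l) (reverse (toList w))
    ≡⟨ coeffQK-flip (toList w) refl pos (f _) (f′ _) (trans (length-toList w) (sym q+l≡n)) ⟨
  coeffQK (replicate q 0 ++ l) (toList w)
    ≡⟨ cong (λ c → coeffQK c (toList w)) b≡ ⟨
  coeffQK (toList b) (toList w) ∎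
  where
  open ≡-Reasoning
  q+l≡n : q + length l ≡ n
  q+l≡n = trans (+-comm q (length l)) (trans (cong (length l +_) (sym (length-replicate q)))
    (trans (sym (length-++ l)) (trans (cong length (sym a≡)) (length-toList a))))

  |b| : length (replicate q 0 ++ l) ≡ n
  |b| = trans (length-++ (replicate q 0)) (trans (cong (_+ length l) (length-replicate q)) q+l≡n)

  vec : ∀ {n} xs → length xs ≡ n → ∃ λ (v : Vec ℕ n) → toList v ≡ xs
  vec xs refl = Vec.fromList xs , toList∘fromList xs

  b = proj₁ (vec (replicate q 0 ++ l) |b|)
  b≡ = proj₂ (vec (replicate q 0 ++ l) |b|)

gentle : ∀ {l} → All (0 <_) l → AdjDiffLe1 l → Gentle l
gentle {l} pos adj = record
  { positive = λ i i< → positive i i< pos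
  ; ascent   = λ i i< → proj₂ (steps i i< adj)
  ; descent  = λ i i< → proj₁ (steps i i< adj)
  }
  where
  positive : ∀ {l} i → i < length l → All (0 <_) l → 0 < l ! i
  positive zero    _  (p ∷ _)  = p
  positive (suc i) i< (_ ∷ ps) = positive i (s<s⁻¹ i<) ps

  steps : ∀ {l} i → suc i < length l → AdjDiffLe1 l → l ! i ≤ suc (l ! suc i) × l ! suc i ≤ suc (l ! i)
  steps i       (s≤s ()) [ x ]
  steps zero    i<       (h ∷ _)   = h
  steps (suc i) i<       (_ ∷ adj) = steps i (s<s⁻¹ i<) adj

sufficiency : ∀ {n} (a : Vec ℕ n) → Condition a → ∃ λ (b : Vec ℕ n) → youngQuasiKey a ≈P quasiKey b
-- Equal parts 0 are absorbed into the zeros, leaving the empty composition to flip.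
sufficiency a (inj₁ (zero , p , q , e)) = coeffQK-flat a [] (p + q) (trans e (++-replicate p)) []
  (λ n → flip-ones-twos n 0 [] []) (λ n → flip-ones-twos n 0 [] [])
  where
  ++-replicate : ∀ p → replicate p 0 ++ replicate q 0 ≡ replicate (p + q) 0
  ++-replicate zero    = refl
  ++-replicate (suc p) = cong (0 ∷_) (++-replicate p)
sufficiency a (inj₁ (suc k , p , q , e)) = coeffQK-flat a (replicate p (suc k)) q e (replicate-All p z<s)
  (λ n → flip-rectangle n p k) (λ n → subst (Flip n) (sym (reverse-replicate p (suc k))) (flip-rectangle n p k))
sufficiency a (inj₂ (inj₁ (l , q , h , e))) = coeffQK-flat a l q e
  (All.map (λ { (inj₁ refl) → z<s ; (inj₂ refl) → z<s }) h)
  (λ n → flip-ones-twos n 0 l h)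
  (λ n → flip-ones-twos n 0 (reverse l) (All-reverse h))
sufficiency a (inj₂ (inj₂ (pos , adj))) = a , λ w →
  sym (coeffQK-gentle {toList a} {toList w} (gentle pos adj) (trans (length-toList w) (sym (length-toList a))))

necessity : ∀ {n} (a b : Vec ℕ n) → quasiKey b ≈P youngQuasiKey a → Condition a
necessity {n} a b eq = Necessity.condition (toList a) (length-toList a) (situation record
  { |b|  = length-toList b
  ; |A|  = trans (length-reverse (toList a)) (length-toList a)
  ; to   = coeffQK-mirrors {a = A} {toList b} λ w |w| → trans
      (cong (coeffQK A) (sym (reverse-involutive w)))
      (sym (eq-list (reverse w) (trans (length-reverse w) |w|)))
  ; from = coeffQK-mirrors {a = toList b} {A} eq-list
  })
  where
  A = reverse (toList a)

  eq-list : ∀ w → length w ≡ n → coeffQK (toList b) w ≡ coeffQK A (reverse w)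
  eq-list w refl = subst (λ w → coeffQK (toList b) w ≡ coeffQK A (reverse w)) (toList∘fromList w) (eq (Vec.fromList w))

mainTheorem14 : (n : ℕ) (P : Vec ℕ n → ℕ) →
    ((Σ (Vec ℕ n) λ b → P ≈P quasiKey b) × (Σ (Vec ℕ n) λ a → P ≈P youngQuasiKey a))
    ⇔ (Σ (Vec ℕ n) λ a → Condition a × P ≈P youngQuasiKey a)
mainTheorem14 n P = mk⇔
  (λ ((b , P≈b) , (a , P≈a)) → a , necessity a b (λ w → trans (sym (P≈b w)) (P≈a w)) , P≈a)
  (λ (a , c , P≈a) → let (b , a≈b) = sufficiency a c in (b , λ w → trans (P≈a w) (a≈b w)) , (a , P≈a))
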